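{- Let $G$ be a bi-block graph with $N=\sum_{k=1}^r(m_k+n_k)-r+1$ vertices and $r>1$ blocks $K_{m_k,n_k}$, and let $q$ satisfy $q\neq-1$, $q^2(m_k-1)(n_k-1)\neq1$ and $(q+1)^2(m_k-1)(n_k-1)\neq m_kn_k$ for all $k$. Let $\mathscr{D}$ be the $q$-distance matrix of $G$ and $\mathscr{L}$, $\mathbf{x}$, $\lambda_G$ as defined below. Then $\mathscr{D}$ is invertible and $$\mathscr{D}^{ -1}=-\mathscr{L}+\frac{1}{\lambda_G}\mathbf{x}\mathbf{x}^T.$$
   Context: $q$ is a real or complex number (the paper calls it an indeterminate). For an integer $\alpha\ge1$, $[\alpha]=1+q+\cdots+q^{\alpha-1}$, $[0]=0$; the $q$-distance matrix $\mathscr{D}$ of a connected graph with vertices $v_1,\dots,v_N$ has $(i,j)$ entry $[d(v_i,v_j)]$, $d$ the shortest-path distance. A bi-block graph is a connected graph each of whose blocks (maximal connected subgraphs without a cut-vertex) is complete bipartite; its blocks are $K_{m_k,n_k}$ with a fixed bipartition $X_k\cup Y_k$, $|X_k|=m_k$, $|Y_k|=n_k$. Let $\hat d(v)$ be the number of blocks containing $v$, and $\Delta_k=q^2(m_k-1)(n_k-1)-1$. Define $\mathbf{x}(v)=\sum_{k:\,v\in X_k}\frac{q(n_k-1)-1}{(q+1)\Delta_k}+\sum_{k:\,v\in Y_k}\frac{q(m_k-1)-1}{(q+1)\Delta_k}-(\hat d(v)-1)$ and $\mathbf{y}(v)=\sum_{k:\,v\in X_k}\frac{n_k-1}{\Delta_k}+\sum_{k:\,v\in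 Y_k}\frac{m_k-1}{\Delta_k}-(\hat d(v)-1)$. Let $\mathbf{A}$ be the $N\times N$ matrix with $(u,v)$ entry $1/\Delta_k$ if $u\sim v$ and the edge $uv$ lies in block $K_{m_k,n_k}$, and $0$ otherwise. Let $\mathbf{B}$ be the $N\times N$ matrix with $(u,v)$ entry $\frac{n_k-1}{\Delta_k}$ if $u\neq v$ and $u,v\in X_k$ for some $k$, $\frac{m_k-1}{\Delta_k}$ if $u\neq v$ and $u,v\in Y_k$ for some $k$, and $0$ otherwise. Define $$\mathscr{L}=\frac{q}{q+1}\mathbf{A}-\frac{q^2}{q+1}\mathbf{B}-\frac{q^2}{q+1}\mathrm{diag}(\mathbf{y})+\frac{1}{q+1}\mathbf{I}_N,\qquad \lambda_G=\sum_{k=1}^r\frac{(q+1)^2(m_k-1)(n_k-1)-m_kn_k}{(q+1)\left(q^2(m_k-1)(n_k-1)-1\right)}.$$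
   Formalization: The condition λ_G ≠ 0 is added: for numeric q the other conditions do not imply it (the 4-cycle K_{2,2} with a pendant edge and q = −2 gives λ_G = 0 and a singular q-distance matrix); q is taken in an arbitrary field. -}

module Defs where

open import Level using (Level; _⊔_) renaming (suc to lsuc)
open import Algebra.Bundles using (CommutativeRing)
open import Data.Nat as ℕ using (ℕ; zero; suc; _≤_)
open import Data.Fin using (Fin) renaming (zero to fzero; suc to fsuc)
open import Data.Fin.Properties using () renaming (_≟_ to _≟ᶠ_)
open import Data.Fin.Subset using (Subset; _∈_; _∪_)
open import Data.Vec using (lookup)
open import Data.Bool using (Bool; true; false; if_then_else_; _∧_; _∨_)
open import Data.Product using (Σ; ∃; _×_; _,_)
open import Data.Sum using (_⊎_)
open import Data.Unit using (⊤)
open import Relation.Nullary using (¬_; yes; no)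
open import Relation.Binary.PropositionalEquality using (_≡_; _≢_)

record Field (c ℓ : Level) : Set (lsuc (c ⊔ ℓ)) where
  field
    commutativeRing : CommutativeRing c ℓ
  open CommutativeRing commutativeRing public
  field
    _⁻¹        : Carrier → Carrier
    0≉1        : ¬ (0# ≈ 1#)
    ⁻¹-inverse : ∀ x → ¬ (x ≈ 0#) → x * (x ⁻¹) ≈ 1#

record Graph (N : ℕ) : Set where
  field
    adj     : Fin N → Fin N → Bool
    adj-sym : ∀ u v → adj u v ≡ adj v u
    adj-irr : ∀ u → adj u u ≡ false

module _ {N : ℕ} (G : Graph N) where
  open Graph G

  Adj : Fin N → Fin N → Set
  Adj u v = adj u v ≡ true

  data WalkIn (S : Fin N → Set) : Fin N → Fin N → ℕ → Set where
    here : ∀ {u} → S u → WalkIn S u u 0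
    step : ∀ {u v w ℓ} → S u → Adj u v → WalkIn S v w ℓ → WalkIn S u w (suc ℓ)

  All : Fin N → Set
  All _ = ⊤

  Walk : Fin N → Fin N → ℕ → Set
  Walk = WalkIn All

  IsDistance : Fin N → Fin N → ℕ → Set
  IsDistance u v d = Walk u v d × (∀ ℓ → Walk u v ℓ → d ≤ ℓ)

  -- any two vertices of S are joined by a walk inside S
  -- (i.e. the induced subgraph G[S] is connected, possibly empty)
  Linked : (Fin N → Set) → Set
  Linked S = ∀ u v → S u → S v → ∃ λ ℓ → WalkIn S u v ℓ

  Connected : Set
  Connected = Linked All

  Nonseparable : (Fin N → Set) → Set
  Nonseparable S =
    (∃ λ v → S v) × Linked S ×
    (∀ v → S v → Linked (λ u → S u × u ≢ v))

  -- S is (the vertex set of) a block: a maximal nonseparable subgraph.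
  -- (Blocks are induced subgraphs, so they are determined by vertex sets.)
  IsBlock : (Fin N → Set) → Set₁
  IsBlock S = Nonseparable S ×
    (∀ (T : Fin N → Set) → (∀ v → S v → T v) → Nonseparable T → ∀ v → T v → S v)

record BiBlockStructure {N : ℕ} (G : Graph N) (r : ℕ)
    (X Y : Fin r → Subset N) (m n : Fin r → ℕ) : Set₁ where
  field
    connected   : Connected G
    card-X      : ∀ k → Data.Fin.Subset.∣ X k ∣ ≡ m k
    card-Y      : ∀ k → Data.Fin.Subset.∣ Y k ∣ ≡ n k
    m-pos       : ∀ k → 1 ≤ m k
    n-pos       : ∀ k → 1 ≤ n k
    disjoint    : ∀ k v → v ∈ X k → ¬ (v ∈ Y k)
    bipartite   : ∀ k u v → u ∈ (X k ∪ Y k) → v ∈ (X k ∪ Y k) →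
                  (Adj G u v → (u ∈ X k × v ∈ Y k) ⊎ (u ∈ Y k × v ∈ X k)) ×
                  ((u ∈ X k × v ∈ Y k) ⊎ (u ∈ Y k × v ∈ X k) → Adj G u v)
    is-block    : ∀ k → IsBlock G (λ v → v ∈ (X k ∪ Y k))
    all-blocks  : ∀ (S : Fin N → Set) → IsBlock G S →
                  ∃ λ k → ∀ v → (S v → v ∈ (X k ∪ Y k)) × (v ∈ (X k ∪ Y k) → S v)
    distinct    : ∀ k l → (∀ v → (v ∈ (X k ∪ Y k) → v ∈ (X l ∪ Y l)) ×
                                 (v ∈ (X l ∪ Y l) → v ∈ (X k ∪ Y k))) → k ≡ l

∑ℕ : ∀ {n} → (Fin n → ℕ) → ℕ
∑ℕ {zero}  f = 0
∑ℕ {suc n} f = f fzero ℕ.+ ∑ℕ (λ i → f (fsuc i))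

module QDist {c ℓ} (F : Field c ℓ) (q : Field.Carrier F) where
  open Field F

  infixl 6 _−_
  infixl 7 _÷_

  _−_ : Carrier → Carrier → Carrier
  x − y = x + (- y)

  _÷_ : Carrier → Carrier → Carrier
  x ÷ y = x * (y ⁻¹)

  ι : ℕ → Carrier
  ι zero    = 0#
  ι (suc k) = 1# + ι k

  qint : ℕ → Carrier
  qint zero    = 0#
  qint (suc α) = 1# + q * qint α

  ∑ : ∀ {n} → (Fin n → Carrier) → Carrier
  ∑ {zero}  f = 0#
  ∑ {suc n} f = f fzero + ∑ (λ i → f (fsuc i))

  ind : Bool → Carrier → Carrier
  ind b x = if b then x else 0#

  infixl 7 _⊗_

  Matrix : ℕ → Set c
  Matrix N = Fin N → Fin N → Carrier

  _⊗_ : ∀ {N} → Matrix N → Matrix N → Matrix N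
  (M ⊗ P) i j = ∑ (λ k → M i k * P k j)

  𝐈 : ∀ {N} → Matrix N
  𝐈 i j with i ≟ᶠ j
  ... | yes _ = 1#
  ... | no  _ = 0#

  qDistMatrix : ∀ {N} → (Fin N → Fin N → ℕ) → Matrix N
  qDistMatrix d i j = qint (d i j)

  module Bi {N r : ℕ} (G : Graph N) (X Y : Fin r → Subset N) (m n : Fin r → ℕ) where
    open Graph G

    inX inY inB : Fin r → Fin N → Bool
    inX k v = lookup (X k) v
    inY k v = lookup (Y k) v
    inB k v = inX k v ∨ inY k v

    M1 N1 : Fin r → Carrier
    M1 k = ι (m k) − 1#
    N1 k = ι (n k) − 1#

    Δ : Fin r → Carrier
    Δ k = q * q * M1 k * N1 k − 1#

    dhat : Fin N → ℕ
    dhat v = ∑ℕ (λ k → if inB k v then 1 else 0)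

    𝐱 : Fin N → Carrier
    𝐱 v = ∑ (λ k → ind (inX k v) ((q * N1 k − 1#) ÷ ((q + 1#) * Δ k))
                 + ind (inY k v) ((q * M1 k − 1#) ÷ ((q + 1#) * Δ k)))
          − (ι (dhat v) − 1#)

    𝐲 : Fin N → Carrier
    𝐲 v = ∑ (λ k → ind (inX k v) (N1 k ÷ Δ k) + ind (inY k v) (M1 k ÷ Δ k))
          − (ι (dhat v) − 1#)

    -- A(u,v) = 1/Δ_k if u ~ v and the edge uv lies in the block k
    -- (the edge lies in exactly one block: the one containing both ends)
    𝐀 : Matrix N
    𝐀 u v = if adj u v then ∑ (λ k → ind (inB k u ∧ inB k v) (1# ÷ Δ k)) else 0#

    𝐁 : Matrix N
    𝐁 u v with u ≟ᶠ v
    ... | yes _ = 0#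
    ... | no  _ = ∑ (λ k → ind (inX k u ∧ inX k v) (N1 k ÷ Δ k)
                         + ind (inY k u ∧ inY k v) (M1 k ÷ Δ k))

    diag : (Fin N → Carrier) → Matrix N
    diag w i j = w i * 𝐈 i j

    𝓛 : Matrix N
    𝓛 u v = (q ÷ (q + 1#)) * 𝐀 u v
          − ((q * q) ÷ (q + 1#)) * 𝐁 u v
          − ((q * q) ÷ (q + 1#)) * diag 𝐲 u v
          + (1# ÷ (q + 1#)) * 𝐈 u v

    λG : Carrier
    λG = ∑ (λ k → ((q + 1#) * (q + 1#) * M1 k * N1 k − ι (m k) * ι (n k))
                  ÷ ((q + 1#) * (q * q * M1 k * N1 k − 1#)))

    𝓓inv : Matrix N
    𝓓inv u v = - 𝓛 u v + (1# ÷ λG) * (𝐱 u * 𝐱 v)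

{-# OPTIONS --safe #-}

-- In a block B_k every vertex w has a gate γ: the distance from each v ∈ B_k to w is
-- d(v,γ) + d(γ,w). Blocks are convex for simple paths (adding a simple path with distinct ends in
-- the block would keep it nonseparable), so all simple paths from the block to w leave it
-- through γ. Moreover every v ≠ w is the gate of w in all blocks containing v except one.
-- Since [a + b] = [b] + q^b [a], the sums (𝓛 D)(u,w) and (D 𝐱)(w) then split into sums over the
-- blocks, each evaluated by an identity of rational functions in q, m_k, n_k; this gives
-- 𝓛 D + I = 𝐱 1ᵀ and D 𝐱 = λ 1, whence (−𝓛 + λ⁻¹ 𝐱 𝐱ᵀ) D = I, and transposition gives the rest.
module Submission where

open import Defs
open import Algebra.Bundles using (CommutativeRing)
import Algebra.Properties.Ring
import Algebra.Properties.Semiring.Mult.TCOptimised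
import Algebra.Properties.Semiring.Sum
import Algebra.Solver.Ring
open import Algebra.Solver.Ring.AlmostCommutativeRing using (fromCommutativeRing; _-Raw-AlmostCommutative⟶_)
open import Data.Bool using (Bool; true; false; if_then_else_; _∧_; _∨_)
open import Data.Empty using (⊥; ⊥-elim)
open import Data.Fin using (Fin) renaming (zero to fzero; suc to fsuc)
open import Data.Fin.Properties using (any?) renaming (_≟_ to _≟ᶠ_)
open import Data.Fin.Subset using (Subset; _∈_; _∪_; ⁅_⁆; ∣_∣; inside; outside; _⊆_; Nonempty)
open import Data.Fin.Subset.Properties
open import Data.Integer as ℤ using (ℤ; -[1+_]; _⊖_; _◃_)
import Data.Integer.Properties as ℤₚ
open import Data.Maybe using (Maybe; just; nothing)
open import Data.Nat as ℕ using (ℕ; zero; suc; _<_; _≤_; z≤n; s≤s) renaming (_+_ to _+ℕ_)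
import Data.Nat.Properties as ℕₚ
open import Data.Product using (Σ; ∃; ∃₂; _×_; _,_; proj₁; proj₂)
import Data.Sign as Sign
open import Data.Sum as Sum using (_⊎_; inj₁; inj₂; [_,_]′)
open import Data.Unit using (⊤; tt)
open import Data.Vec using (_∷_; []; here; there; lookup)
open import Data.Vec.Properties using ([]=⇒lookup; lookup⇒[]=)
open import Function using (_∘_; id)
import Relation.Binary.Reasoning.Setoid
open import Relation.Binary.PropositionalEquality as ≡ using (_≡_; _≢_; ≢-sym)
open import Relation.Nullary using (¬_; Dec; yes; no; contradiction)
open import Relation.Nullary.Decidable using (_×-dec_; _⊎-dec_; decidable-stable; ¬¬-excluded-middle)
open import Relation.Unary using (Decidable)

-- No block is removed and no induction on the block tree is made. A column `w` of the distance
-- matrix is fixed; on each block it is the affine image E + q^d(γ,w) [d(v,γ)] of the block's own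
-- column at the gate γ. Writing the power as p = 1 + (q - 1) E makes the local identities
-- polynomial in E, and `w` drops out of them because p - (q - 1) E = 1. The corrections `dhat v` -
-- 1 in `𝐱` and `𝐲` are matched by the gates: each block receives one correction, located at its
-- gate, with a remainder only at `w`. The constructive obstacle is that maximality of a block is
-- tested against arbitrary predicates. Such a predicate is a finite subset only up to double
-- negation. This suffices, since the goals at stake are a contradiction or the decidable question
-- whether one of the `r` blocks contains both ends of an edge.

¬¬-toSubset : ∀ {n} (T : Fin n → Set) →
              ¬ ¬ Σ (Subset n) λ s → ∀ v → (T v → v ∈ s) × (v ∈ s → T v)
¬¬-toSubset {zero}  T k = k ([] , λ ())
¬¬-toSubset {suc n} T k = ¬¬-toSubset (T ∘ fsuc) λ (s , s⇔T) → ¬¬-excluded-middle λ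
  { (yes t) → k (inside ∷ s , λ { fzero    → (λ _ → here) , (λ _ → t)
                                ; (fsuc v) → there ∘ proj₁ (s⇔T v) , proj₂ (s⇔T v) ∘ drop-there })
  ; (no ¬t) → k (outside ∷ s , λ { fzero    → (λ t → contradiction t ¬t) , λ ()
                                 ; (fsuc v) → there ∘ proj₁ (s⇔T v) , proj₂ (s⇔T v) ∘ drop-there }) }

-- Walks, blocks and gates in an arbitrary finite graph.

module Walks {N : ℕ} (G : Graph N) where
  open Graph G

  V : Set
  V = Fin N

  private
    variable
      S T : V → Set
      u v w x y z : V
      a b ℓ : ℕ

  adj-≢ : Adj G u v → u ≢ v
  adj-≢ {u} a ≡.refl with ≡.trans (≡.sym a) (adj-irr u)
  ... | ()

  Adj-sym : Adj G u v → Adj G v u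
  Adj-sym {u} {v} = ≡.trans (adj-sym v u)

  start∈ : WalkIn G S u v ℓ → S u
  start∈ (here s)     = s
  start∈ (step s _ _) = s

  end∈ : WalkIn G S u v ℓ → S v
  end∈ (here s)     = s
  end∈ (step _ _ p) = end∈ p

  mapʷ : (∀ z → S z → T z) → WalkIn G S u v ℓ → WalkIn G T u v ℓ
  mapʷ f (here s)     = here (f _ s)
  mapʷ f (step s e p) = step (f _ s) e (mapʷ f p)

  infixr 5 _++ʷ_
  _++ʷ_ : WalkIn G S u v a → WalkIn G S v w b → WalkIn G S u w (a +ℕ b)
  here _     ++ʷ r = r
  step s e p ++ʷ r = step s e (p ++ʷ r)

  snocʷ : WalkIn G S u v ℓ → Adj G v w → S w → WalkIn G S u w (suc ℓ)
  snocʷ (here s)     f t = step s f (here t)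
  snocʷ (step s e p) f t = step s e (snocʷ p f t)

  reverseʷ : WalkIn G S u v ℓ → WalkIn G S v u ℓ
  reverseʷ (here s)     = here s
  reverseʷ (step s e p) = snocʷ (reverseʷ p) (Adj-sym e) s

  infix 4 _∈ʷ_
  _∈ʷ_ : V → Walk G u v ℓ → Set
  z ∈ʷ here {u} _     = z ≡ u
  z ∈ʷ step {u} _ _ p = z ≡ u ⊎ z ∈ʷ p

  _∈ʷ?_ : ∀ z (p : Walk G u v ℓ) → Dec (z ∈ʷ p)
  z ∈ʷ? here _     = z ≟ᶠ _
  z ∈ʷ? step _ _ p = (z ≟ᶠ _) ⊎-dec (z ∈ʷ? p)

  start∈ʷ : (p : Walk G u v ℓ) → u ∈ʷ p
  start∈ʷ (here _)     = ≡.refl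
  start∈ʷ (step _ _ _) = inj₁ ≡.refl

  end∈ʷ : (p : Walk G u v ℓ) → v ∈ʷ p
  end∈ʷ (here _)     = ≡.refl
  end∈ʷ (step _ _ p) = inj₂ (end∈ʷ p)

  Simple : Walk G u v ℓ → Set
  Simple (here _)         = ⊤
  Simple (step {u} _ _ p) = ¬ u ∈ʷ p × Simple p

  record Split (z : V) (p : Walk G u v ℓ) : Set where
    constructor splitting
    field
      {len₁ len₂} : ℕ
      prefix      : Walk G u z len₁
      suffix      : Walk G z v len₂
      len         : len₁ +ℕ len₂ ≡ ℓ
      prefix⊆     : ∀ {x} → x ∈ʷ prefix → x ∈ʷ p
      suffix⊆     : ∀ {x} → x ∈ʷ suffix → x ∈ʷ p
      prefix-simple : Simple p → Simple prefix
      suffix-simple : Simple p → Simple suffix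

  split : (p : Walk G u v ℓ) → z ∈ʷ p → Split z p
  split p@(here _)     ≡.refl        = splitting (here tt) p ≡.refl id id id id
  split p@(step _ _ _) (inj₁ ≡.refl) =
    splitting (here tt) p ≡.refl (λ { ≡.refl → inj₁ ≡.refl }) id (λ _ → tt) id
  split (step _ e p)   (inj₂ z∈p)  = splitting (step tt e prefix) suffix (≡.cong suc len)
      (Sum.map₂ prefix⊆) (inj₂ ∘ suffix⊆)
      (λ (u∉p , s) → u∉p ∘ prefix⊆ , prefix-simple s) (suffix-simple ∘ proj₂)
    where open Split (split p z∈p)

  -- The bound `length≤` lets a loop-erased geodesic stand in for the geodesic itself in distance
  -- estimates.
  record SimpleWalk (u v : V) (ℓ : ℕ) (P : V → Set) : Set where
    constructor simpleWalk
    field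
      {length}     : ℕ
      walk         : Walk G u v length
      length≤      : length ≤ ℓ
      simple       : Simple walk
      within       : ∀ {z} → z ∈ʷ walk → P z

  loop-erase : (p : Walk G u v ℓ) → SimpleWalk u v ℓ (_∈ʷ p)
  loop-erase (here _) = simpleWalk (here tt) z≤n tt id
  loop-erase (step {u} _ e p) with loop-erase p
  ... | simpleWalk p′ p′≤p simple p′⊆p with u ∈ʷ? p′
  ...   | no  u∉p′ = simpleWalk (step tt e p′) (s≤s p′≤p) (u∉p′ , simple) (Sum.map₂ p′⊆p)
  ...   | yes u∈p′ = simpleWalk suffix
                       (ℕₚ.m≤n⇒m≤1+n (ℕₚ.≤-trans (ℕₚ.m+n≤o⇒n≤o len₁ (ℕₚ.≤-reflexive len)) p′≤p))
                       (suffix-simple simple) (inj₂ ∘ p′⊆p ∘ suffix⊆)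
    where open Split (split p′ u∈p′)

  to-end : (p : Walk G u v ℓ) → y ∈ʷ p → ∃ λ k → WalkIn G (_∈ʷ p) y v k
  to-end p@(here _)     ≡.refl        = _ , here ≡.refl
  to-end p@(step _ e r) (inj₁ ≡.refl) = _ , step (inj₁ ≡.refl) e (mapʷ (λ _ → inj₂) (proj₂ (to-end r (start∈ʷ r))))
  to-end (step _ e r)   (inj₂ y∈r)  = _ , mapʷ (λ _ → inj₂) (proj₂ (to-end r y∈r))

  -- A simple walk visits x at most once, so x blocks the way from y to at most one of the two ends.
  escape : (p : Walk G u v ℓ) → Simple p → y ∈ʷ p → y ≢ x →
           (∃ λ k → WalkIn G (λ z → z ∈ʷ p × z ≢ x) y u k) ⊎
           (∃ λ k → WalkIn G (λ z → z ∈ʷ p × z ≢ x) y v k)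
  escape (here _) _ ≡.refl y≢x = inj₁ (_ , here (≡.refl , y≢x))
  escape (step _ _ _) _ (inj₁ ≡.refl) y≢x = inj₁ (_ , here (inj₁ ≡.refl , y≢x))
  escape {u = u} {x = x} (step _ e p) (u∉p , sp) (inj₂ y∈p) y≢x with escape p sp y∈p y≢x
  ... | inj₂ (_ , q) = inj₂ (_ , mapʷ (λ _ (z∈p , z≢x) → inj₂ z∈p , z≢x) q)
  ... | inj₁ (_ , q) with u ≟ᶠ x
  ...   | no  u≢x  = inj₁ (_ , snocʷ (mapʷ (λ _ (z∈p , z≢x) → inj₂ z∈p , z≢x) q) (Adj-sym e) (inj₁ ≡.refl , u≢x))
  -- Here x is the first vertex; by simplicity the rest of the walk avoids it, so all of it leads
  -- safely to the far end.
  ...   | yes ≡.refl = inj₂ (_ , mapʷ (λ { _ z∈p → inj₂ z∈p , λ { ≡.refl → u∉p z∈p } }) (proj₂ (to-end p y∈p)))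

  -- The meeting vertex is recorded because the argument for gates turns on it: it lies on the
  -- joined walk and on both given walks.
  record Join (p : Walk G u v a) (q : Walk G v w b) : Set where
    constructor joined
    field
      {length} : ℕ
      walk     : Walk G u w length
      simple   : Simple walk
      within   : ∀ {z} → z ∈ʷ walk → z ∈ʷ p ⊎ z ∈ʷ q
      {meet}   : V
      meet∈    : meet ∈ʷ walk
      meet∈₁   : meet ∈ʷ p
      meet∈₂   : meet ∈ʷ q

  -- Follow p up to its first vertex on q, then follow q.
  join : (p : Walk G u v a) (q : Walk G v w b) → Simple p → Simple q → Join p q
  join (here _) q _ sq = joined q sq inj₂ (start∈ʷ q) ≡.refl (start∈ʷ q)
  join (step {u} _ e p) q (u∉p , sp) sq with u ∈ʷ? q
  ... | yes u∈q = joined suffix (suffix-simple sq) (inj₂ ∘ suffix⊆) (start∈ʷ suffix) (inj₁ ≡.refl) u∈q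
    where open Split (split q u∈q)
  ... | no  u∉q with join p q sp sq
  ...   | joined r sr r⊆ m∈r m∈p m∈q = joined (step tt e r) ([ u∉p , u∉q ]′ ∘ r⊆ , sr)
            [ inj₁ ∘ inj₁ , Sum.map₁ inj₂ ∘ r⊆ ]′ (inj₂ m∈r) (inj₂ m∈p) m∈q

  Linked-via : (S T : V → Set) → (∀ z → S z → T z) → Linked G S →
               (∀ y → T y → ∃₂ λ b ℓ → S b × WalkIn G T y b ℓ) → Linked G T
  Linked-via S T S⊆T linked reach u v u∈T v∈T with reach u u∈T | reach v v∈T
  ... | _ , _ , b∈S , p | _ , _ , c∈S , q =
    _ , p ++ʷ mapʷ S⊆T (proj₂ (linked _ _ b∈S c∈S)) ++ʷ reverseʷ q

  Nonseparable-resp : (∀ z → S z → T z) → (∀ z → T z → S z) →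
                      Nonseparable G S → Nonseparable G T
  Nonseparable-resp to from ((v , v∈S) , linked , linked∖) =
    (v , to v v∈S) ,
    (λ u v u∈T v∈T → _ , mapʷ to (proj₂ (linked u v (from u u∈T) (from v v∈T)))) ,
    (λ x x∈T u v (u∈T , u≢x) (v∈T , v≢x) →
       _ , mapʷ (λ z (z∈S , z≢x) → to z z∈S , z≢x)
             (proj₂ (linked∖ x (from x x∈T) u v (from u u∈T , u≢x) (from v v∈T , v≢x))))

  -- The vertex x need not lie in S, in which case nothing is removed.
  linked-∖ : Decidable S → Nonseparable G S → ∀ x → Linked G (λ z → S z × z ≢ x)
  linked-∖ {S} S? (_ , linked , linked∖) x with S? x
  ... | yes x∈S = linked∖ x x∈S
  ... | no  x∉S = λ u v (u∈S , _) (v∈S , _) →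
    _ , mapʷ (λ { z z∈S → z∈S , λ { ≡.refl → x∉S z∈S } }) (proj₂ (linked u v u∈S v∈S))

  module _ (S? : Decidable S) (block : IsBlock G S) where
    private
      nonsep : Nonseparable G S
      nonsep = proj₁ block

    -- Adding a simple path with distinct end points in S to S keeps it nonseparable.
    block-convex : (p : Walk G u v ℓ) → Simple p → S u → S v → u ≢ v → ∀ {z} → z ∈ʷ p → S z
    block-convex {u} {v} p sp u∈S v∈S u≢v z∈p =
      proj₂ block U (λ _ → inj₁) U-nonsep _ (inj₂ z∈p)
      where
      U : V → Set
      U y = S y ⊎ y ∈ʷ p

      reach∖ : ∀ x y → U y × y ≢ x →
               ∃₂ λ b ℓ → (S b × b ≢ x) × WalkIn G (λ y → U y × y ≢ x) y b ℓ
      reach∖ x y (inj₁ y∈S , y≢x) = y , 0 , (y∈S , y≢x) , here (inj₁ y∈S , y≢x)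
      reach∖ x y (inj₂ y∈p , y≢x) with escape p sp y∈p y≢x
      -- The walk avoids x up to and including its last vertex, so the end of the path that it
      -- reaches survives the deletion of x.
      ... | inj₁ (_ , q) = _ , _ , (u∈S , proj₂ (end∈ q)) , mapʷ (λ _ (z∈p , z≢x) → inj₂ z∈p , z≢x) q
      ... | inj₂ (_ , q) = _ , _ , (v∈S , proj₂ (end∈ q)) , mapʷ (λ _ (z∈p , z≢x) → inj₂ z∈p , z≢x) q

      reach : ∀ y → U y → ∃₂ λ b ℓ → S b × WalkIn G U y b ℓ
      reach y (inj₁ y∈S) = y , 0 , y∈S , here (inj₁ y∈S)
      reach y (inj₂ y∈p) = _ , _ , v∈S , mapʷ (λ _ → inj₂) (proj₂ (to-end p y∈p))

      U-nonsep : Nonseparable G U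
      U-nonsep = (u , inj₁ u∈S) , Linked-via S U (λ _ → inj₁) (proj₁ (proj₂ nonsep)) reach ,
        λ x _ → Linked-via (λ y → S y × y ≢ x) (λ y → U y × y ≢ x)
                  (λ _ (y∈S , y≢x) → inj₁ y∈S , y≢x) (linked-∖ S? nonsep x) (reach∖ x)

    first-hit : (p : Walk G u v ℓ) → S v →
                ∃₂ λ g k → S g × Σ (Walk G u g k) λ q → ∀ {z} → z ∈ʷ q → S z → z ≡ g
    first-hit (here _) v∈S = _ , _ , v∈S , here tt , λ z≡v _ → z≡v
    first-hit (step {u} _ e p) v∈S with S? u
    ... | yes u∈S = _ , _ , u∈S , here tt , λ z≡u _ → z≡u
    ... | no  u∉S with first-hit p v∈S
    ...   | g , _ , g∈S , q , q∩S = g , _ , g∈S , step tt e q ,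
              λ { (inj₁ ≡.refl) u∈S → contradiction u∈S u∉S ; (inj₂ z∈q) z∈S → q∩S z∈q z∈S }

    -- Phrased with all simple walks rather than with distances: applied to a loop-erased geodesic
    -- it gives additivity of distances, applied to the trivial walk it identifies the gate of a
    -- vertex of the block, and it also controls the first edge of a walk.
    IsGate : V → V → Set
    IsGate u g = S g × (∀ {v ℓ} (p : Walk G v u ℓ) → Simple p → S v → g ∈ʷ p)

    -- Let q be a simple walk from u that meets the block only in its end g. A simple walk p from v
    -- to u joins with q to a simple walk from v to g, which stays in the block by convexity. Its
    -- meeting vertex is thus a block vertex on q, hence g, and it lies on p.
    gate : Connected G → ∀ u → ∃ (IsGate u)
    gate connected u with nonsep
    ... | (b , b∈S) , _ with first-hit (proj₂ (connected u b tt tt)) b∈S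
    ...   | g , _ , g∈S , q₀ , q₀∩S = g , g∈S , through
      where
      open SimpleWalk (loop-erase q₀) renaming (walk to q; simple to sq; within to q⊆q₀)

      through : ∀ {v ℓ} (p : Walk G v u ℓ) → Simple p → S v → g ∈ʷ p
      through {v} p sp v∈S with v ≟ᶠ g
      ... | yes ≡.refl = start∈ʷ p
      ... | no  v≢g  with join p q sp sq
      ...   | joined r sr _ m∈r m∈p m∈q =
        ≡.subst (_∈ʷ p) (q₀∩S (q⊆q₀ m∈q) (block-convex r sr v∈S g∈S v≢g m∈r)) m∈p

  -- Deleting one vertex from the union leaves a or b, through which the remainders of the two
  -- blocks stay linked. The union is therefore nonseparable, and maximality of `S` absorbs `T`.
  -- Adjacency of a and b does not enter.
  shared-edge⇒⊆ : Decidable S → Decidable T → IsBlock G S → IsBlock G T →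
                  ∀ {a b} → a ≢ b → S a → S b → T a → T b → ∀ z → T z → S z
  shared-edge⇒⊆ {S} {T} S? T? (nsS , maxS) (nsT , _) {a} {b} a≢b a∈S b∈S a∈T b∈T z z∈T =
    maxS U (λ _ → inj₁) U-nonsep z (inj₂ z∈T)
    where
    U : V → Set
    U y = S y ⊎ T y

    reach : ∀ y → U y → ∃₂ λ b ℓ → S b × WalkIn G U y b ℓ
    reach y (inj₁ y∈S) = y , 0 , y∈S , here (inj₁ y∈S)
    reach y (inj₂ y∈T) = a , _ , a∈S , mapʷ (λ _ → inj₂) (proj₂ (proj₁ (proj₂ nsT) y a y∈T a∈T))

    other : ∀ x → ∃ λ c → S c × T c × c ≢ x
    other x with a ≟ᶠ x
    ... | no  a≢x  = a , a∈S , a∈T , a≢x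
    ... | yes ≡.refl = b , b∈S , b∈T , ≢-sym a≢b

    reach∖ : ∀ x y → U y × y ≢ x →
             ∃₂ λ b ℓ → (S b × b ≢ x) × WalkIn G (λ y → U y × y ≢ x) y b ℓ
    reach∖ x y (inj₁ y∈S , y≢x) = y , 0 , (y∈S , y≢x) , here (inj₁ y∈S , y≢x)
    reach∖ x y (inj₂ y∈T , y≢x) with other x
    ... | c , c∈S , c∈T , c≢x = c , _ , (c∈S , c≢x) ,
      mapʷ (λ _ (z∈T , z≢x) → inj₂ z∈T , z≢x)
           (proj₂ (linked-∖ T? nsT x y c (y∈T , y≢x) (c∈T , c≢x)))

    U-nonsep : Nonseparable G U
    U-nonsep = (a , inj₁ a∈S) , Linked-via S U (λ _ → inj₁) (proj₁ (proj₂ nsS)) reach ,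
      λ x _ → Linked-via (λ y → S y × y ≢ x) (λ y → U y × y ≢ x)
                (λ _ (y∈S , y≢x) → inj₁ y∈S , y≢x) (linked-∖ S? nsS x) (reach∖ x)

  edge-nonseparable : Adj G u v → Nonseparable G (_∈ ⁅ u ⁆ ∪ ⁅ v ⁆)
  edge-nonseparable {u} {v} e =
    Nonseparable-resp
      (λ z → x∈p∪q⁺ ∘ Sum.map (λ { ≡.refl → x∈⁅x⁆ z }) (λ { ≡.refl → x∈⁅x⁆ z }))
      (λ z → Sum.map (x∈⁅y⁆⇒x≡y u) (x∈⁅y⁆⇒x≡y v) ∘ x∈p∪q⁻ ⁅ u ⁆ ⁅ v ⁆)
      ((u , inj₁ ≡.refl) , linked , linked∖)
    where
    E : V → Set
    E z = z ≡ u ⊎ z ≡ v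

    linked : Linked G E
    linked _ _ (inj₁ ≡.refl) (inj₁ ≡.refl) = _ , here (inj₁ ≡.refl)
    linked _ _ (inj₁ ≡.refl) (inj₂ ≡.refl) = _ , step (inj₁ ≡.refl) e (here (inj₂ ≡.refl))
    linked _ _ (inj₂ ≡.refl) (inj₁ ≡.refl) = _ , step (inj₂ ≡.refl) (Adj-sym e) (here (inj₁ ≡.refl))
    linked _ _ (inj₂ ≡.refl) (inj₂ ≡.refl) = _ , here (inj₂ ≡.refl)

    linked∖ : ∀ x → E x → Linked G (λ z → E z × z ≢ x)
    -- Of two vertices one is deleted, so y and z must be the one that is left.
    linked∖ x x∈E y z (y∈E , y≢x) (z∈E , z≢x) with same x∈E y∈E z∈E
      where
      same : E x → E y → E z → y ≡ z
      same (inj₁ ≡.refl) (inj₁ ≡.refl) _           = contradiction ≡.refl y≢x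
      same (inj₁ ≡.refl) _           (inj₁ ≡.refl) = contradiction ≡.refl z≢x
      same (inj₂ ≡.refl) (inj₂ ≡.refl) _           = contradiction ≡.refl y≢x
      same (inj₂ ≡.refl) _           (inj₂ ≡.refl) = contradiction ≡.refl z≢x
      same (inj₁ ≡.refl) (inj₂ ≡.refl) (inj₂ ≡.refl) = ≡.refl
      same (inj₂ ≡.refl) (inj₁ ≡.refl) (inj₁ ≡.refl) = ≡.refl
    ... | ≡.refl = _ , here (y∈E , y≢x)

  -- Constructively only the double negation is available, since nonseparability of an
  -- arbitrary predicate is not decidable; the recursion is on the number of vertices outside s.
  ¬¬-in-block : ∀ fuel (s : Subset N) → N ≤ fuel +ℕ ∣ s ∣ → Nonseparable G (_∈ s) →
                ¬ (∀ t → s ⊆ t → ¬ IsBlock G (_∈ t))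
  ¬¬-in-block fuel s N≤ ns none = none s id (ns , maximal)
    where
    maximal : ∀ (T : V → Set) → (∀ v → v ∈ s → T v) → Nonseparable G T → ∀ v → T v → v ∈ s
    maximal T s⊆T nsT v v∈T with v ∈? s
    ... | yes v∈s = v∈s
    -- Deciding membership in `s` has reduced the goal to a contradiction, so `T` may be replaced by
    -- a finite subset; it properly contains `s`, and the recursion applies to it.
    ... | no  v∉s = ⊥-elim (¬¬-toSubset T λ (t , t⇔T) →
          enlarge fuel N≤ t (λ {z} z∈s → proj₁ (t⇔T z) (s⊆T z z∈s)) (proj₁ (t⇔T v) v∈T)
            (Nonseparable-resp (λ z → proj₁ (t⇔T z)) (λ z → proj₂ (t⇔T z)) nsT))
      where
      enlarge : ∀ fuel → N ≤ fuel +ℕ ∣ s ∣ → ∀ t → s ⊆ t → v ∈ t → Nonseparable G (_∈ t) → ⊥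
      -- Without fuel `s` already has `N` elements and has no proper superset.
      enlarge zero N≤ t s⊆t v∈t _ =
        ℕₚ.<-irrefl ≡.refl (ℕₚ.<-≤-trans (p⊂q⇒∣p∣<∣q∣ (s⊆t , v , v∈t , v∉s)) (ℕₚ.≤-trans (∣p∣≤n t) N≤))
      enlarge (suc fuel) N≤ t s⊆t v∈t nst = ¬¬-in-block fuel t
        (ℕₚ.≤-trans N≤ (ℕₚ.≤-trans (ℕₚ.≤-reflexive (≡.sym (ℕₚ.+-suc fuel ∣ s ∣)))
          (ℕₚ.+-monoʳ-≤ fuel (p⊂q⇒∣p∣<∣q∣ (s⊆t , v , v∈t , v∉s)))))
        nst (λ t′ t⊆t′ → none t′ (t⊆t′ ∘ s⊆t))

∣p∣≥1⇒nonempty : ∀ {n} (p : Subset n) → 1 ≤ ∣ p ∣ → Nonempty p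
∣p∣≥1⇒nonempty {n} p 1≤∣p∣ with nonempty? p
... | yes ne = ne
... | no ¬ne with Empty-unique ¬ne
...   | ≡.refl = contradiction (ℕₚ.≤-trans 1≤∣p∣ (ℕₚ.≤-reflexive (∣⊥∣≡0 n))) λ ()

-- Distances between vertices that are adjacent or share a neighbour.

module Distance {N : ℕ} (G : Graph N) (d : Fin N → Fin N → ℕ)
                (dist : ∀ u v → IsDistance G u v (d u v)) where
  open Walks G

  geodesic : ∀ u v → Walk G u v (d u v)
  geodesic u v = proj₁ (dist u v)

  d≤length : ∀ {u v ℓ} → Walk G u v ℓ → d u v ≤ ℓ
  d≤length = proj₂ (dist _ _) _

  d-refl : ∀ u → d u u ≡ 0
  d-refl u = ℕₚ.n≤0⇒n≡0 (d≤length (here tt))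

  d-sym : ∀ u v → d u v ≡ d v u
  d-sym u v = ℕₚ.≤-antisym (d≤length (reverseʷ (geodesic v u))) (d≤length (reverseʷ (geodesic u v)))

  Walk₀⇒≡ : ∀ {u v} → Walk G u v 0 → u ≡ v
  Walk₀⇒≡ (here _) = ≡.refl

  Walk₁⇒Adj : ∀ {u v} → Walk G u v 1 → Adj G u v
  Walk₁⇒Adj (step _ e (here _)) = e

  d-Adj : ∀ {u v} → Adj G u v → d u v ≡ 1
  d-Adj {u} {v} e with d u v | geodesic u v | d≤length (step tt e (here tt))
  ... | 0 | p | _ = contradiction (Walk₀⇒≡ p) (adj-≢ e)
  ... | 1 | _ | _ = ≡.refl
  ... | suc (suc _) | _ | s≤s ()

  d-common-neighbour : ∀ {u v w} → u ≢ v → ¬ Adj G u v → Adj G u w → Adj G w v → d u v ≡ 2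
  d-common-neighbour {u} {v} u≢v ¬e e f with d u v | geodesic u v | d≤length (step tt e (step tt f (here tt)))
  ... | 0 | p | _ = contradiction (Walk₀⇒≡ p) u≢v
  ... | 1 | p | _ = contradiction (Walk₁⇒Adj p) ¬e
  ... | 2 | _ | _ = ≡.refl
  ... | suc (suc (suc _)) | _ | s≤s (s≤s ())

-- Gates and distances in a bi-block graph.

module BiBlockGraph {N r : ℕ} {G : Graph N} {X Y : Fin r → Subset N} {m n : Fin r → ℕ}
    (bb : BiBlockStructure G r X Y m n)
    (d : Fin N → Fin N → ℕ) (dist : ∀ u v → IsDistance G u v (d u v)) where
  open BiBlockStructure bb
  open Walks G
  open Distance G d dist

  B : Fin r → V → Set
  B k v = v ∈ X k ∪ Y k

  B? : ∀ k → Decidable (B k)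
  B? k v = v ∈? (X k ∪ Y k)

  X⊆B : ∀ k {v} → v ∈ X k → B k v
  X⊆B k = x∈p∪q⁺ ∘ inj₁

  Y⊆B : ∀ k {v} → v ∈ Y k → B k v
  Y⊆B k = x∈p∪q⁺ ∘ inj₂

  -- Searching the finitely many listed blocks is decidable, which removes the double negation from
  -- the existence of a maximal nonseparable set around the edge.
  edge-in-block : ∀ {u v} → Adj G u v → ∃ λ k → B k u × B k v
  edge-in-block {u} {v} e = decidable-stable (any? λ k → B? k u ×-dec B? k v) λ ¬∃ →
    ¬¬-in-block N (⁅ u ⁆ ∪ ⁅ v ⁆) (ℕₚ.m≤m+n N _) (edge-nonseparable e) λ t ⊆t block →
      let (k , t⇔B) = all-blocks _ block in
      ¬∃ (k , proj₁ (t⇔B u) (⊆t (x∈p∪q⁺ (inj₁ (x∈⁅x⁆ u))))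
            , proj₁ (t⇔B v) (⊆t (x∈p∪q⁺ (inj₂ (x∈⁅x⁆ v)))))

  shared-edge⇒≡ : ∀ k l {u v} → u ≢ v → B k u → B k v → B l u → B l v → k ≡ l
  shared-edge⇒≡ k l u≢v ku kv lu lv = distinct k l λ z →
    shared-edge⇒⊆ (B? l) (B? k) (is-block l) (is-block k) u≢v lu lv ku kv z ,
    shared-edge⇒⊆ (B? k) (B? l) (is-block k) (is-block l) u≢v ku kv lu lv z

  γ : Fin r → V → V
  γ k u = proj₁ (gate (B? k) (is-block k) connected u)

  γ∈B : ∀ k u → B k (γ k u)
  γ∈B k u = proj₁ (proj₂ (gate (B? k) (is-block k) connected u))

  through-γ : ∀ k {u v ℓ} (p : Walk G v u ℓ) → Simple p → B k v → γ k u ∈ʷ p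
  through-γ k {u} = proj₂ (proj₂ (gate (B? k) (is-block k) connected u))

  γ-self : ∀ k {u} → B k u → γ k u ≡ u
  γ-self k = through-γ k (here tt) tt

  -- A loop-erased geodesic passes the gate; its two pieces bound the two distances, and the
  -- triangle inequality gives the converse.
  d-through-γ : ∀ k u {v} → B k v → d v u ≡ d v (γ k u) +ℕ d (γ k u) u
  d-through-γ k u {v} v∈B = ℕₚ.≤-antisym
    (d≤length (geodesic v (γ k u) ++ʷ geodesic (γ k u) u))
    (ℕₚ.≤-trans (ℕₚ.+-mono-≤ (d≤length prefix) (d≤length suffix))
      (ℕₚ.≤-trans (ℕₚ.≤-reflexive len) length≤))
    where
    open SimpleWalk (loop-erase (geodesic v u))
    open Split (split walk (through-γ k walk simple v∈B))

  -- A simple walk from v to u starts with the same edge in both blocks.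
  γ-≢-unique : ∀ k l {u v} → B k v → B l v → γ k u ≢ v → γ l u ≢ v → k ≡ l
  γ-≢-unique k l {u} {v} v∈k v∈l γk≢v γl≢v = first-edge walk simple
    where
    open SimpleWalk (loop-erase (geodesic v u))

    next∈B : ∀ j {w ℓ} (e : Adj G v w) (p : Walk G w u ℓ) → Simple (step tt e p) →
             B j v → γ j u ≢ v → B j w
    next∈B j e p s@(v∉p , sp) v∈j γ≢v with through-γ j (step tt e p) s v∈j
    ... | inj₁ γ≡v = contradiction γ≡v γ≢v
    -- The walk from v to the gate is simple with distinct ends in the block, so convexity puts its
    -- second vertex w into the block.
    ... | inj₂ γ∈p = block-convex (B? j) (is-block j) (step tt e prefix)
                       (v∉p ∘ prefix⊆ , prefix-simple sp) v∈j (γ∈B j u) (≢-sym γ≢v)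
                       (inj₂ (start∈ʷ prefix))
      where open Split (split p γ∈p)

    first-edge : ∀ {ℓ} (p : Walk G v u ℓ) → Simple p → k ≡ l
    first-edge (here _)     _ = contradiction (γ-self k v∈k) γk≢v
    first-edge (step _ e p) s = shared-edge⇒≡ k l (adj-≢ e)
      v∈k (next∈B k e p s v∈k γk≢v) v∈l (next∈B l e p s v∈l γl≢v)

  -- The block of the first edge vw of a simple walk from v to u serves: its gate lies on the rest
  -- of the walk, from w on, which avoids v.
  γ-≢-exists : ∀ {u v} → u ≢ v → ∃ λ k → B k v × γ k u ≢ v
  γ-≢-exists {u} {v} u≢v = first-edge walk simple
    where
    open SimpleWalk (loop-erase (geodesic v u))

    first-edge : ∀ {ℓ} (p : Walk G v u ℓ) → Simple p → ∃ λ k → B k v × γ k u ≢ v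
    first-edge (here _)     _          = contradiction ≡.refl u≢v
    first-edge (step _ e p) (v∉p , sp) with edge-in-block e
    ... | k , v∈k , w∈k = k , v∈k , λ γ≡v → v∉p (≡.subst (_∈ʷ p) γ≡v (through-γ k p sp w∈k))

  adj-XY : ∀ k {u v} → u ∈ X k → v ∈ Y k → Adj G u v
  adj-XY k u∈X v∈Y = proj₂ (bipartite k _ _ (X⊆B k u∈X) (Y⊆B k v∈Y)) (inj₁ (u∈X , v∈Y))

  ¬adj-XX : ∀ k {u v} → u ∈ X k → v ∈ X k → ¬ Adj G u v
  ¬adj-XX k u∈X v∈X e with proj₁ (bipartite k _ _ (X⊆B k u∈X) (X⊆B k v∈X)) e
  ... | inj₁ (_ , v∈Y) = disjoint k _ v∈X v∈Y
  ... | inj₂ (u∈Y , _) = disjoint k _ u∈X u∈Y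

  ¬adj-YY : ∀ k {u v} → u ∈ Y k → v ∈ Y k → ¬ Adj G u v
  ¬adj-YY k u∈Y v∈Y e with proj₁ (bipartite k _ _ (Y⊆B k u∈Y) (Y⊆B k v∈Y)) e
  ... | inj₁ (u∈X , _) = disjoint k _ u∈X u∈Y
  ... | inj₂ (_ , v∈X) = disjoint k _ v∈X v∈Y

  d-XY : ∀ k {u v} → u ∈ X k → v ∈ Y k → d u v ≡ 1
  d-XY k u∈X v∈Y = d-Adj (adj-XY k u∈X v∈Y)

  d-XX : ∀ k {u v} → u ∈ X k → v ∈ X k → u ≢ v → d u v ≡ 2
  d-XX k u∈X v∈X u≢v with ∣p∣≥1⇒nonempty (Y k) (≡.subst (1 ≤_) (≡.sym (card-Y k)) (n-pos k))
  ... | _ , y∈Y = d-common-neighbour u≢v (¬adj-XX k u∈X v∈X)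
                    (adj-XY k u∈X y∈Y) (Adj-sym (adj-XY k v∈X y∈Y))

  d-YY : ∀ k {u v} → u ∈ Y k → v ∈ Y k → u ≢ v → d u v ≡ 2
  d-YY k u∈Y v∈Y u≢v with ∣p∣≥1⇒nonempty (X k) (≡.subst (1 ≤_) (≡.sym (card-X k)) (m-pos k))
  ... | _ , x∈X = d-common-neighbour u≢v (¬adj-YY k u∈Y v∈Y)
                    (Adj-sym (adj-XY k x∈X u∈Y)) (adj-XY k x∈X v∈Y)

-- Normalisation of polynomial identities in a commutative ring.

-- The ring solver cancels terms only if the coefficients have decidable equality; the
-- integers serve, through their canonical homomorphism to any commutative ring.
module IntegerCoefficients {c ℓ} (R : CommutativeRing c ℓ) where
  open CommutativeRing R
  open Algebra.Properties.Ring ring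
    using (-‿distribˡ-*; -‿distribʳ-*; -0#≈0#; -‿involutive; -‿+-comm)
  open Algebra.Properties.Semiring.Mult.TCOptimised semiring using (1+×; ×-homo-+; ×1-homo-*)
    renaming (_×_ to _·_)
  open Relation.Binary.Reasoning.Setoid setoid

  ⟦_⟧ : ℤ → Carrier
  ⟦ ℤ.+ n ⟧    = n · 1#
  ⟦ -[1+ n ] ⟧ = - (suc n · 1#)

  ⊖-homo : ∀ m n → ⟦ m ⊖ n ⟧ ≈ m · 1# + - (n · 1#)
  ⊖-homo m       zero    = sym (trans (+-congˡ -0#≈0#) (+-identityʳ _))
  ⊖-homo zero    (suc n) = sym (+-identityˡ _)
  ⊖-homo (suc m) (suc n) = begin
    ⟦ suc m ⊖ suc n ⟧                          ≡⟨ ≡.cong ⟦_⟧ (ℤₚ.[1+m]⊖[1+n]≡m⊖n m n) ⟩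
    ⟦ m ⊖ n ⟧                                  ≈⟨ ⊖-homo m n ⟩
    m · 1# + - (n · 1#)                        ≈⟨ +-congʳ (+-identityˡ _) ⟨
    0# + m · 1# + - (n · 1#)                   ≈⟨ +-congʳ (+-congʳ (-‿inverseʳ 1#)) ⟨
    1# + - 1# + m · 1# + - (n · 1#)            ≈⟨ +-congʳ (trans (+-assoc _ _ _) (trans (+-congˡ (+-comm _ _)) (sym (+-assoc _ _ _)))) ⟩
    1# + m · 1# + - 1# + - (n · 1#)            ≈⟨ +-assoc _ _ _ ⟩
    1# + m · 1# + (- 1# + - (n · 1#))          ≈⟨ +-cong (sym (1+× m 1#)) (trans (-‿+-comm _ _) (-‿cong (sym (1+× n 1#)))) ⟩
    suc m · 1# + - (suc n · 1#)                ∎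

  neg-homo : ∀ i → ⟦ ℤ.- i ⟧ ≈ - ⟦ i ⟧
  neg-homo (ℤ.+ zero)    = sym -0#≈0#
  neg-homo (ℤ.+ (suc n)) = refl
  neg-homo -[1+ n ]      = sym (-‿involutive _)

  +-homo : ∀ i j → ⟦ i ℤ.+ j ⟧ ≈ ⟦ i ⟧ + ⟦ j ⟧
  +-homo (ℤ.+ m)  (ℤ.+ n)  = ×-homo-+ 1# m n
  +-homo (ℤ.+ m)  -[1+ n ] = ⊖-homo m (suc n)
  +-homo -[1+ m ] (ℤ.+ n)  = trans (⊖-homo n (suc m)) (+-comm _ _)
  +-homo -[1+ m ] -[1+ n ] = begin
    - (suc (suc (m ℕ.+ n)) · 1#)       ≡⟨ ≡.cong (λ k → - (suc k · 1#)) (ℕₚ.+-suc m n) ⟨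
    - ((suc m ℕ.+ suc n) · 1#)         ≈⟨ -‿cong (×-homo-+ 1# (suc m) (suc n)) ⟩
    - (suc m · 1# + suc n · 1#)        ≈⟨ -‿+-comm _ _ ⟨
    - (suc m · 1#) + - (suc n · 1#)    ∎

  *-homo : ∀ i j → ⟦ i ℤ.* j ⟧ ≈ ⟦ i ⟧ * ⟦ j ⟧
  *-homo (ℤ.+ m)  (ℤ.+ n)  = trans (reflexive (≡.cong ⟦_⟧ (ℤₚ.+◃n≡+n (m ℕ.* n)))) (×1-homo-* m n)
  *-homo (ℤ.+ m)  -[1+ n ] = begin
    ⟦ Sign.- ◃ m ℕ.* suc n ⟧         ≡⟨ ≡.cong ⟦_⟧ (ℤₚ.-◃n≡-n (m ℕ.* suc n)) ⟩
    ⟦ ℤ.- (ℤ.+ (m ℕ.* suc n)) ⟧      ≈⟨ neg-homo (ℤ.+ (m ℕ.* suc n)) ⟩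
    - ((m ℕ.* suc n) · 1#)           ≈⟨ -‿cong (×1-homo-* m (suc n)) ⟩
    - ((m · 1#) * (suc n · 1#))      ≈⟨ -‿distribʳ-* _ _ ⟩
    (m · 1#) * - (suc n · 1#)        ∎
  *-homo -[1+ m ] (ℤ.+ n)  = begin
    ⟦ Sign.- ◃ suc m ℕ.* n ⟧         ≡⟨ ≡.cong ⟦_⟧ (ℤₚ.-◃n≡-n (suc m ℕ.* n)) ⟩
    ⟦ ℤ.- (ℤ.+ (suc m ℕ.* n)) ⟧      ≈⟨ neg-homo (ℤ.+ (suc m ℕ.* n)) ⟩
    - ((suc m ℕ.* n) · 1#)           ≈⟨ -‿cong (×1-homo-* (suc m) n) ⟩
    - ((suc m · 1#) * (n · 1#))      ≈⟨ -‿distribˡ-* _ _ ⟩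
    - (suc m · 1#) * (n · 1#)        ∎
  *-homo -[1+ m ] -[1+ n ] = begin
    (suc m ℕ.* suc n) · 1#               ≈⟨ ×1-homo-* (suc m) (suc n) ⟩
    (suc m · 1#) * (suc n · 1#)          ≈⟨ -‿involutive _ ⟨
    - (- ((suc m · 1#) * (suc n · 1#)))  ≈⟨ -‿cong (-‿distribˡ-* _ _) ⟩
    - (- (suc m · 1#) * (suc n · 1#))    ≈⟨ -‿distribʳ-* _ _ ⟩
    - (suc m · 1#) * - (suc n · 1#)      ∎

  homomorphism : ℤ.+-*-rawRing -Raw-AlmostCommutative⟶ fromCommutativeRing R
  homomorphism = record
    { ⟦_⟧ = ⟦_⟧ ; +-homo = +-homo ; *-homo = *-homo ; -‿homo = neg-homo
    ; 0-homo = refl ; 1-homo = refl }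

  ≈-weakly-decidable : ∀ i j → Maybe (⟦ i ⟧ ≈ ⟦ j ⟧)
  ≈-weakly-decidable i j with i ℤ.≟ j
  ... | yes ≡.refl = just refl
  ... | no  _      = nothing

  module Solver = Algebra.Solver.Ring ℤ.+-*-rawRing (fromCommutativeRing R) homomorphism ≈-weakly-decidable

-- Finite sums, indicator vectors and q-integers over the field.

module LinearAlgebra {c ℓ} (F : Field c ℓ) (q : Field.Carrier F) where
  open Field F
  open QDist F q
  open Algebra.Properties.Semiring.Sum semiring using (sum; sum-cong-≋; ∑-distrib-+; ∑-comm; *-distribˡ-sum)
  open IntegerCoefficients commutativeRing using (module Solver)
  open Solver using (solve; _:=_; con; _:+_; _:*_; _:-_)
  open Relation.Binary.Reasoning.Setoid setoid

  *-≉0 : ∀ {x y} → ¬ (x ≈ 0#) → ¬ (y ≈ 0#) → ¬ (x * y ≈ 0#)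
  *-≉0 {x} {y} x≉0 y≉0 xy≈0 = y≉0 (begin
    y                  ≈⟨ *-identityˡ y ⟨
    1# * y             ≈⟨ *-congʳ (⁻¹-inverse x x≉0) ⟨
    x * x ⁻¹ * y       ≈⟨ solve 3 (λ x i y → x :* i :* y := x :* y :* i) refl x (x ⁻¹) y ⟩
    x * y * x ⁻¹       ≈⟨ *-congʳ xy≈0 ⟩
    0# * x ⁻¹          ≈⟨ zeroˡ _ ⟩
    0#                 ∎)

  ≉⇒−≉0 : ∀ {x y} → ¬ (x ≈ y) → ¬ (x − y ≈ 0#)
  ≉⇒−≉0 {x} {y} x≉y x−y≈0 = x≉y (begin
    x              ≈⟨ solve 2 (λ x y → x := x :- y :+ y) refl x y ⟩
    x − y + y      ≈⟨ +-congʳ x−y≈0 ⟩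
    0# + y         ≈⟨ +-identityˡ y ⟩
    y              ∎)

  ∑≡sum : ∀ {n} (f : Fin n → Carrier) → ∑ f ≡ sum f
  ∑≡sum {zero}  f = ≡.refl
  ∑≡sum {suc n} f = ≡.cong (f fzero +_) (∑≡sum (λ i → f (fsuc i)))

  ∑-cong : ∀ {n} {f g : Fin n → Carrier} → (∀ i → f i ≈ g i) → ∑ f ≈ ∑ g
  ∑-cong {f = f} {g} f≈g rewrite ∑≡sum f | ∑≡sum g = sum-cong-≋ f≈g

  ∑-+ : ∀ {n} (f g : Fin n → Carrier) → ∑ (λ i → f i + g i) ≈ ∑ f + ∑ g
  ∑-+ f g rewrite ∑≡sum f | ∑≡sum g | ∑≡sum (λ i → f i + g i) = ∑-distrib-+ f g

  *-∑ : ∀ {n} x (f : Fin n → Carrier) → x * ∑ f ≈ ∑ (λ i → x * f i)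
  *-∑ x f rewrite ∑≡sum f | ∑≡sum (λ i → x * f i) = *-distribˡ-sum x f

  ∑-* : ∀ {n} (f : Fin n → Carrier) x → ∑ f * x ≈ ∑ (λ i → f i * x)
  ∑-* f x = trans (*-comm _ _) (trans (*-∑ x f) (∑-cong λ i → *-comm x (f i)))

  ∑-− : ∀ {n} (f g : Fin n → Carrier) → ∑ (λ i → f i − g i) ≈ ∑ f − ∑ g
  ∑-− f g = begin
    ∑ (λ i → f i − g i)              ≈⟨ ∑-cong (λ i → solve 2 (λ x y → x :- y := x :+ con (ℤ.- ℤ.1ℤ) :* y) refl (f i) (g i)) ⟩
    ∑ (λ i → f i + - 1# * g i)       ≈⟨ ∑-+ f (λ i → - 1# * g i) ⟩
    ∑ f + ∑ (λ i → - 1# * g i)       ≈⟨ +-congˡ (*-∑ (- 1#) g) ⟨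
    ∑ f + - 1# * ∑ g                 ≈⟨ solve 2 (λ x y → x :- y := x :+ con (ℤ.- ℤ.1ℤ) :* y) refl (∑ f) (∑ g) ⟨
    ∑ f − ∑ g                        ∎

  ∑-swap : ∀ {m n} (f : Fin m → Fin n → Carrier) →
           ∑ (λ i → ∑ (λ j → f i j)) ≈ ∑ (λ j → ∑ (λ i → f i j))
  ∑-swap {m} {n} f = begin
    ∑ (λ i → ∑ (λ j → f i j))        ≈⟨ ∑-cong (λ i → reflexive (∑≡sum (f i))) ⟩
    ∑ (λ i → sum (λ j → f i j))      ≡⟨ ∑≡sum (λ i → sum (λ j → f i j)) ⟩
    sum (λ i → sum (λ j → f i j))    ≈⟨ ∑-comm f ⟩
    sum (λ j → sum (λ i → f i j))    ≡⟨ ∑≡sum (λ j → sum (λ i → f i j)) ⟨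
    ∑ (λ j → sum (λ i → f i j))      ≈⟨ ∑-cong (λ j → reflexive (∑≡sum (λ i → f i j))) ⟨
    ∑ (λ j → ∑ (λ i → f i j))        ∎

  ∑-0 : ∀ n → ∑ {n} (λ _ → 0#) ≈ 0#
  ∑-0 zero    = refl
  ∑-0 (suc n) = trans (+-identityˡ _) (∑-0 n)

  ∑-lin₃ : ∀ {n} x y z (f g h : Fin n → Carrier) →
           ∑ (λ i → x * f i + y * g i + z * h i) ≈ x * ∑ f + y * ∑ g + z * ∑ h
  ∑-lin₃ x y z f g h = begin
    ∑ (λ i → x * f i + y * g i + z * h i)
      ≈⟨ trans (∑-+ (λ i → x * f i + y * g i) (λ i → z * h i)) (+-congʳ (∑-+ (λ i → x * f i) (λ i → y * g i))) ⟩
    ∑ (λ i → x * f i) + ∑ (λ i → y * g i) + ∑ (λ i → z * h i)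
      ≈⟨ +-cong (+-cong (*-∑ x f) (*-∑ y g)) (*-∑ z h) ⟨
    x * ∑ f + y * ∑ g + z * ∑ h ∎

  if-∑ : ∀ {k} b (f : Fin k → Carrier) → (if b then ∑ f else 0#) ≈ ∑ (λ i → if b then f i else 0#)
  if-∑     true  f = refl
  if-∑ {k} false f = sym (∑-0 k)

  𝐈-≢ : ∀ {n} {i j : Fin n} → i ≢ j → 𝐈 i j ≡ 0#
  𝐈-≢ {i = i} {j} i≢j with i ≟ᶠ j
  ... | yes i≡j = contradiction i≡j i≢j
  ... | no  _   = ≡.refl

  𝐈-refl : ∀ {n} (i : Fin n) → 𝐈 i i ≡ 1#
  𝐈-refl i with i ≟ᶠ i
  ... | yes _   = ≡.refl
  ... | no  i≢i = contradiction ≡.refl i≢i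

  𝐈-sym : ∀ {n} (i j : Fin n) → 𝐈 i j ≡ 𝐈 j i
  𝐈-sym i j with i ≟ᶠ j
  ... | yes ≡.refl = ≡.sym (𝐈-refl i)
  ... | no  i≢j    = ≡.sym (𝐈-≢ (λ j≡i → i≢j (≡.sym j≡i)))

  𝐈-suc : ∀ {n} (i j : Fin n) → 𝐈 (fsuc i) (fsuc j) ≡ 𝐈 i j
  𝐈-suc i j with i ≟ᶠ j
  ... | yes _ = ≡.refl
  ... | no  _ = ≡.refl

  𝐈-replace : ∀ {n} (f : Fin n → Carrier) i j → 𝐈 i j * f i ≈ 𝐈 i j * f j
  𝐈-replace f i j with i ≟ᶠ j
  ... | yes ≡.refl = refl
  ... | no  _      = trans (zeroˡ _) (sym (zeroˡ _))

  ∑-𝐈 : ∀ {n} (i : Fin n) (f : Fin n → Carrier) → ∑ (λ j → 𝐈 i j * f j) ≈ f i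
  ∑-𝐈 {suc n} fzero    f = begin
    1# * f fzero + ∑ (λ j → 0# * f (fsuc j))   ≈⟨ +-cong (*-identityˡ _) (∑-cong (λ j → zeroˡ (f (fsuc j)))) ⟩
    f fzero + ∑ {n} (λ _ → 0#)                 ≈⟨ +-congˡ (∑-0 n) ⟩
    f fzero + 0#                               ≈⟨ +-identityʳ _ ⟩
    f fzero                                    ∎
  ∑-𝐈 (fsuc i) f = begin
    0# * f fzero + ∑ (λ j → 𝐈 (fsuc i) (fsuc j) * f (fsuc j))
      ≈⟨ +-cong (zeroˡ _) (∑-cong (λ j → *-congʳ (reflexive (𝐈-suc i j)))) ⟩
    0# + ∑ (λ j → 𝐈 i j * f (fsuc j))   ≈⟨ +-identityˡ _ ⟩
    ∑ (λ j → 𝐈 i j * f (fsuc j))        ≈⟨ ∑-𝐈 i (λ j → f (fsuc j)) ⟩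
    f (fsuc i)                          ∎

  χ : ∀ {n} → Subset n → Fin n → Carrier
  χ s v = ind (lookup s v) 1#

  χ-∈ : ∀ {n} {s : Subset n} {v} → v ∈ s → χ s v ≡ 1#
  χ-∈ v∈s = ≡.cong (λ b → ind b 1#) ([]=⇒lookup v∈s)

  χ-∉ : ∀ {n} {s : Subset n} {v} → ¬ v ∈ s → χ s v ≡ 0#
  χ-∉ {s = s} {v} v∉s with lookup s v in eq
  ... | true  = contradiction (lookup⇒[]= v s eq) v∉s
  ... | false = ≡.refl

  χ-cong : ∀ {n} (s : Subset n) {f g : Fin n → Carrier} → (∀ {v} → v ∈ s → f v ≈ g v) →
           ∀ v → χ s v * f v ≈ χ s v * g v
  χ-cong s f≈g v with lookup s v in eq
  ... | true  = *-congˡ (f≈g (lookup⇒[]= v s eq))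
  ... | false = trans (zeroˡ _) (sym (zeroˡ _))

  ∑-χ : ∀ {n} (s : Subset n) → ∑ (χ s) ≈ ι ∣ s ∣
  ∑-χ []            = refl
  ∑-χ (inside ∷ s)  = +-congˡ (∑-χ s)
  ∑-χ (outside ∷ s) = trans (+-identityˡ _) (∑-χ s)

  ind≈ : ∀ b x → ind b x ≈ ind b 1# * x
  ind≈ true  x = sym (*-identityˡ x)
  ind≈ false x = sym (zeroˡ x)

  ind-∧ : ∀ b c x → ind (b ∧ c) x ≈ ind b 1# * ind c 1# * x
  ind-∧ true  c x = trans (ind≈ c x) (*-congʳ (sym (*-identityˡ _)))
  ind-∧ false c x = solve 2 (λ y x → con ℤ.0ℤ := con ℤ.0ℤ :* y :* x) refl (ind c 1#) x

  -- The factor in parentheses is q^b. Expressing it through `qint b` keeps all later identities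
  -- polynomial in q and the entries of the distance matrix.
  qint-+ : ∀ a b → qint (a ℕ.+ b) ≈ qint b + (1# + (q − 1#) * qint b) * qint a
  qint-+ zero    b = solve 2 (λ q y → y := y :+ (con ℤ.1ℤ :+ (q :- con ℤ.1ℤ) :* y) :* con ℤ.0ℤ) refl q (qint b)
  qint-+ (suc a) b = trans (+-congˡ (*-congˡ (qint-+ a b)))
    (solve 3 (λ q x y →
      con ℤ.1ℤ :+ q :* (y :+ (con ℤ.1ℤ :+ (q :- con ℤ.1ℤ) :* y) :* x) :=
      y :+ (con ℤ.1ℤ :+ (q :- con ℤ.1ℤ) :* y) :* (con ℤ.1ℤ :+ q :* x)) refl q (qint a) (qint b))

  qint2 : qint 2 ≈ 1# + q
  qint2 = solve 1 (λ q → con ℤ.1ℤ :+ q :* (con ℤ.1ℤ :+ q :* con ℤ.0ℤ) := con ℤ.1ℤ :+ q) refl q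

  ι-+ : ∀ a b → ι (a ℕ.+ b) ≈ ι a + ι b
  ι-+ zero    b = sym (+-identityˡ _)
  ι-+ (suc a) b = trans (+-congˡ (ι-+ a b)) (sym (+-assoc _ _ _))

  ι-∑ℕ : ∀ {n} (f : Fin n → ℕ) → ι (∑ℕ f) ≈ ∑ (λ i → ι (f i))
  ι-∑ℕ {zero}  f = refl
  ι-∑ℕ {suc n} f = trans (ι-+ (f fzero) _) (+-congˡ (ι-∑ℕ (λ i → f (fsuc i))))

-- Rational-function identities of a single block.

module LocalIdentities {c ℓ} (F : Field c ℓ) (q : Field.Carrier F) where
  open Field F
  open QDist F q
  open LinearAlgebra F q
  open IntegerCoefficients commutativeRing using (module Solver)
  open Solver using (solve; _:=_; con; _:+_; _:*_; _:-_; Polynomial)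
  open Relation.Binary.Reasoning.Setoid setoid

  private
    𝟏 : ∀ {n} → Polynomial n
    𝟏 = con ℤ.1ℤ

  -- For a target w behind the gate g of a block, every entry [d(v,w)] equals E + p [d(v,g)],
  -- where E = [d(g,w)] and p = 1 + (q − 1) E is the power q^d(g,w).
  pow : Carrier → Carrier
  pow E = 1# + (q − 1#) * E

  module _ {N : ℕ} (s : Subset N) (D : Fin N → Carrier) (E : Carrier) where

    -- Two vertices on one side are at distance 2, and [2] = 1 + q. The gate itself is the only
    -- exception, whence one correction to `∣ s ∣` equal entries.
    ∑-same-side : ∀ {g} → g ∈ s →
                  (∀ {v} → v ∈ s → D v ≈ E + pow E * (1# + q) * (1# − 𝐈 g v)) →
                  ∑ (λ v → χ s v * D v) ≈ ι ∣ s ∣ * (E + pow E * (1# + q)) − pow E * (1# + q)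
    ∑-same-side {g} g∈s D≈ = begin
      ∑ (λ v → χ s v * D v)
        ≈⟨ ∑-cong (χ-cong s D≈) ⟩
      ∑ (λ v → χ s v * (E + P * (1# − 𝐈 g v)))
        ≈⟨ ∑-cong (λ v → solve 4 (λ x e p i → x :* (e :+ p :* (𝟏 :- i)) := x :* (e :+ p) :- i :* (x :* p))
                           refl (χ s v) E P (𝐈 g v)) ⟩
      ∑ (λ v → χ s v * (E + P) − 𝐈 g v * (χ s v * P))
        ≈⟨ ∑-− (λ v → χ s v * (E + P)) (λ v → 𝐈 g v * (χ s v * P)) ⟩
      ∑ (λ v → χ s v * (E + P)) − ∑ (λ v → 𝐈 g v * (χ s v * P))
        ≈⟨ +-cong (trans (sym (∑-* (χ s) (E + P))) (*-congʳ (∑-χ s)))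
                  (-‿cong (trans (∑-𝐈 g (λ v → χ s v * P))
                                 (trans (*-congʳ (reflexive (χ-∈ g∈s))) (*-identityˡ P)))) ⟩
      ι ∣ s ∣ * (E + P) − P ∎
      where P = pow E * (1# + q)

    ∑-opposite-side : (∀ {v} → v ∈ s → D v ≈ E + pow E) →
                      ∑ (λ v → χ s v * D v) ≈ ι ∣ s ∣ * (E + pow E)
    ∑-opposite-side D≈ = begin
      ∑ (λ v → χ s v * D v)           ≈⟨ ∑-cong (χ-cong s D≈) ⟩
      ∑ (λ v → χ s v * (E + pow E))   ≈⟨ ∑-* (χ s) (E + pow E) ⟨
      ∑ (χ s) * (E + pow E)           ≈⟨ *-congʳ (∑-χ s) ⟩
      ι ∣ s ∣ * (E + pow E)           ∎

  -- a + 1 and b + 1 are the sizes of the sides containing resp. not containing the gate;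
  -- P and Q are the sums of the entries [d(v,w)] over these sides, and W = 1 / ((q + 1) Δ).
  module _ (a b Δ W E P Q : Carrier)
           (Δ≈ : Δ ≈ q * q * a * b − 1#)
           (WΔ : W * ((q + 1#) * Δ) ≈ 1#)
           (P≈ : P ≈ (a + 1#) * (E + pow E * (1# + q)) − pow E * (1# + q))
           (Q≈ : Q ≈ (b + 1#) * (E + pow E)) where

    private
      WΔ′ : W * ((q + 1#) * (q * q * a * b − 1#)) ≈ 1#
      WΔ′ = trans (*-congˡ (*-congˡ (sym Δ≈))) WΔ

    -- The left side is the share of one block in a row of `𝓛` times a column of distances, for a
    -- row vertex on the gate's side. Away from the gate term it equals (q b - 1) W (p - (q - 1) E),
    -- and p - (q - 1) E = 1. The same factor makes `local-row-opposite` independent of E.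
    local-row-same : ∀ {D} I → D ≈ E + pow E * (1# + q) * (1# − I) →
                     W * (q * Q − q * q * b * P + Δ * D) ≈ (q * b − 1#) * W − I * pow E
    local-row-same {D} I D≈ = begin
      W * (q * Q − q * q * b * P + Δ * D)
        ≈⟨ *-congˡ (+-cong (+-cong (*-congˡ Q≈) (-‿cong (*-congˡ P≈))) (*-cong Δ≈ D≈)) ⟩
      W * (q * ((b + 1#) * (E + pow E))
           − q * q * b * ((a + 1#) * (E + pow E * (1# + q)) − pow E * (1# + q))
           + (q * q * a * b − 1#) * (E + pow E * (1# + q) * (1# − I)))
        ≈⟨ solve 6 (λ q a b W E I → let p = 𝟏 :+ (q :- 𝟏) :* E in
             W :* (q :* ((b :+ 𝟏) :* (E :+ p))
               :- q :* q :* b :* ((a :+ 𝟏) :* (E :+ p :* (𝟏 :+ q)) :- p :* (𝟏 :+ q))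
               :+ (q :* q :* a :* b :- 𝟏) :* (E :+ p :* (𝟏 :+ q) :* (𝟏 :- I)))
             := (q :* b :- 𝟏) :* W
                :- I :* p :* (W :* ((q :+ 𝟏) :* (q :* q :* a :* b :- 𝟏)))) refl q a b W E I ⟩
      (q * b − 1#) * W − I * pow E * (W * ((q + 1#) * (q * q * a * b − 1#)))
        ≈⟨ +-congˡ (-‿cong (trans (*-congˡ WΔ′) (*-identityʳ _))) ⟩
      (q * b − 1#) * W − I * pow E ∎

    local-row-opposite : ∀ {D} → D ≈ E + pow E →
                         W * (q * P − q * q * a * Q + Δ * D) ≈ (q * a − 1#) * W
    local-row-opposite {D} D≈ = begin
      W * (q * P − q * q * a * Q + Δ * D)
        ≈⟨ *-congˡ (+-cong (+-cong (*-congˡ P≈) (-‿cong (*-congˡ Q≈))) (*-cong Δ≈ D≈)) ⟩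
      W * (q * ((a + 1#) * (E + pow E * (1# + q)) − pow E * (1# + q))
           − q * q * a * ((b + 1#) * (E + pow E))
           + (q * q * a * b − 1#) * (E + pow E))
        ≈⟨ solve 5 (λ q a b W E → let p = 𝟏 :+ (q :- 𝟏) :* E in
             W :* (q :* ((a :+ 𝟏) :* (E :+ p :* (𝟏 :+ q)) :- p :* (𝟏 :+ q))
               :- q :* q :* a :* ((b :+ 𝟏) :* (E :+ p))
               :+ (q :* q :* a :* b :- 𝟏) :* (E :+ p))
             := (q :* a :- 𝟏) :* W) refl q a b W E ⟩
      (q * a − 1#) * W ∎

    -- The subtracted E is the entry at the gate, where the block's share of the correction in `𝐱`
    -- sits. With E written as E W (q + 1) Δ, the rest again contains p and E only through p - (q -
    -- 1) E = 1.
    local-λ : (q * b − 1#) * W * P + (q * a − 1#) * W * Q − E ≈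
              ((q + 1#) * (q + 1#) * a * b − (a + 1#) * (b + 1#)) * W
    local-λ = begin
      (q * b − 1#) * W * P + (q * a − 1#) * W * Q − E
        ≈⟨ +-cong (+-cong (*-congˡ P≈) (*-congˡ Q≈))
                  (-‿cong (trans (sym (*-identityʳ E)) (*-congˡ (sym WΔ′)))) ⟩
      (q * b − 1#) * W * ((a + 1#) * (E + pow E * (1# + q)) − pow E * (1# + q))
        + (q * a − 1#) * W * ((b + 1#) * (E + pow E))
        − E * (W * ((q + 1#) * (q * q * a * b − 1#)))
        ≈⟨ solve 5 (λ q a b W E → let p = 𝟏 :+ (q :- 𝟏) :* E in
             (q :* b :- 𝟏) :* W :* ((a :+ 𝟏) :* (E :+ p :* (𝟏 :+ q)) :- p :* (𝟏 :+ q))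
             :+ (q :* a :- 𝟏) :* W :* ((b :+ 𝟏) :* (E :+ p))
             :- E :* (W :* ((q :+ 𝟏) :* (q :* q :* a :* b :- 𝟏)))
             := ((q :+ 𝟏) :* (q :+ 𝟏) :* a :* b :- (a :+ 𝟏) :* (b :+ 𝟏)) :* W) refl q a b W E ⟩
      ((q + 1#) * (q + 1#) * a * b − (a + 1#) * (b + 1#)) * W ∎

-- Matching fixes both membership bits of a vertex at once, so the conditionals in the definitions
-- compute, while disjointness of the sides has already excluded two true bits.
data Position : Bool → Bool → Set where
  left    : Position true  false
  right   : Position false true
  neither : Position false false

-- Assembling the blocks: the count of gates and the two matrix identities.

module Inverse {c ℓ} (F : Field c ℓ) (q : Field.Carrier F)
    {N r : ℕ} (G : Graph N) (X Y : Fin r → Subset N) (m n : Fin r → ℕ)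
    (bb : BiBlockStructure G r X Y m n)
    (d : Fin N → Fin N → ℕ) (dist : ∀ u v → IsDistance G u v (d u v)) where
  open Graph G
  open BiBlockStructure bb
  open Walks G using (V)
  open Distance G d dist using (d-refl; d-sym)
  open BiBlockGraph bb d dist
  open Field F
  open QDist F q
  open Bi G X Y m n
  open LinearAlgebra F q
  open LocalIdentities F q
  open IntegerCoefficients commutativeRing using (module Solver)
  open Solver using (solve; _:=_; con; _:+_; _:*_; _:-_; :-_; Polynomial)
  open Relation.Binary.Reasoning.Setoid setoid

  private
    𝟏 𝟎 : ∀ {n} → Polynomial n
    𝟏 = con ℤ.1ℤ
    𝟎 = con ℤ.0ℤ

  D : Matrix N
  D = qDistMatrix d

  χX χY : Fin r → V → Carrier
  χX k = χ (X k)
  χY k = χ (Y k)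

  W : Fin r → Carrier
  W k = ((q + 1#) * Δ k) ⁻¹

  xX xY : Fin r → Carrier
  xX k = (q * N1 k − 1#) * W k
  xY k = (q * M1 k − 1#) * W k

  β : V → Carrier
  β v = ∑ (λ k → χX k v + χY k v) − 1#

  position : ∀ k v → Position (inX k v) (inY k v)
  position k v with lookup (X k) v in eqX | lookup (Y k) v in eqY
  ... | true  | false = left
  ... | false | true  = right
  ... | false | false = neither
  ... | true  | true  = contradiction (lookup⇒[]= v (Y k) eqY) (disjoint k v (lookup⇒[]= v (X k) eqX))

  -- The counterpart of `Position` for arguments that need membership proofs and rewrite with the
  -- values of the indicators.
  data Side (k : Fin r) (v : V) : Set c where
    in-X : v ∈ X k → χX k v ≡ 1# → χY k v ≡ 0# → Side k v
    in-Y : v ∈ Y k → χX k v ≡ 0# → χY k v ≡ 1# → Side k v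
    out  : ¬ B k v → χX k v ≡ 0# → χY k v ≡ 0# → Side k v

  side : ∀ k v → Side k v
  side k v with v ∈? X k | v ∈? Y k
  ... | yes v∈X | _       = in-X v∈X (χ-∈ v∈X) (χ-∉ (disjoint k v v∈X))
  ... | no  v∉X | yes v∈Y = in-Y v∈Y (χ-∉ v∉X) (χ-∈ v∈Y)
  ... | no  v∉X | no  v∉Y = out ([ v∉X , v∉Y ]′ ∘ x∈p∪q⁻ (X k) (Y k)) (χ-∉ v∉X) (χ-∉ v∉Y)

  χB-∈ : ∀ k {v} → B k v → χX k v + χY k v ≈ 1#
  χB-∈ k {v} v∈B with side k v
  ... | in-X _ x y rewrite x | y = +-identityʳ _
  ... | in-Y _ x y rewrite x | y = +-identityˡ _
  ... | out v∉B _ _ = contradiction v∈B v∉B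

  χB-∉ : ∀ k {v} → ¬ B k v → χX k v + χY k v ≈ 0#
  χB-∉ k {v} v∉B with side k v
  ... | in-X v∈X _ _ = contradiction (X⊆B k v∈X) v∉B
  ... | in-Y v∈Y _ _ = contradiction (Y⊆B k v∈Y) v∉B
  ... | out _ x y rewrite x | y = +-identityˡ _

  dhat−1≈β : ∀ v → ι (dhat v) − 1# ≈ β v
  dhat−1≈β v = +-congʳ (trans (ι-∑ℕ (λ k → if inB k v then 1 else 0))
                              (∑-cong λ k → indicator (position k v)))
    where
    indicator : ∀ {x y} → Position x y → ι (if x ∨ y then 1 else 0) ≈ ind x 1# + ind y 1#
    indicator left    = refl
    indicator right   = +-comm _ _
    indicator neither = sym (+-identityˡ _)

  -- Rooting the block tree at u: every vertex v ≠ u is the gate of u in all its blocks but one.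
  gate-count : ∀ u v → β v ≈ ∑ (λ k → 𝐈 (γ k u) v) − 𝐈 u v
  gate-count u v with u ≟ᶠ v
  ... | yes ≡.refl = +-congʳ (∑-cong λ k → at-root k)
    where
    at-root : ∀ k → χX k u + χY k u ≈ 𝐈 (γ k u) u
    -- The root is its own gate in every block containing it and a gate in no other block.
    at-root k with B? k u
    ... | yes u∈B = trans (χB-∈ k u∈B) (reflexive (≡.sym (≡.trans (≡.cong (λ g → 𝐈 g u) (γ-self k u∈B)) (𝐈-refl u))))
    ... | no  u∉B = trans (χB-∉ k u∉B)
                      (reflexive (≡.sym (𝐈-≢ (λ γ≡u → u∉B (≡.subst (B k) γ≡u (γ∈B k u))))))
  ... | no u≢v with γ-≢-exists u≢v
  ...   | l , v∈l , γl≢v = begin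
    Σχ − 1#                        ≈⟨ solve 2 (λ x g → x :- 𝟏 := (x :- g) :- 𝟏 :+ g) refl Σχ Σ𝐈 ⟩
    (Σχ − Σ𝐈) − 1# + Σ𝐈            ≈⟨ +-congʳ (+-congʳ one) ⟩
    1# − 1# + Σ𝐈                   ≈⟨ solve 1 (λ g → 𝟏 :- 𝟏 :+ g := g :- 𝟎) refl Σ𝐈 ⟩
    Σ𝐈 − 0#                        ∎
    where
    Σχ = ∑ (λ k → χX k v + χY k v)
    Σ𝐈 = ∑ (λ k → 𝐈 (γ k u) v)

    -- Only the block `l`, through which v leads towards u, contains v without having it as gate.
    -- The factor `1#` fits the shape of `∑-𝐈`.
    only-l : ∀ k → (χX k v + χY k v) − 𝐈 (γ k u) v ≈ 𝐈 l k * 1#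
    only-l k with l ≟ᶠ k
    ... | yes ≡.refl = trans (+-cong (χB-∈ k v∈l) (-‿cong (reflexive (𝐈-≢ γl≢v))))
                             (solve 0 (𝟏 :- 𝟎 := 𝟏 :* 𝟏) refl)
    ... | no  l≢k with B? k v
    ...   | no  v∉B = trans (+-cong (χB-∉ k v∉B) (-‿cong (reflexive (𝐈-≢ (λ γ≡v → v∉B (≡.subst (B k) γ≡v (γ∈B k u)))))))
                            (solve 0 (𝟎 :- 𝟎 := 𝟎 :* 𝟏) refl)
    ...   | yes v∈B with γ k u ≟ᶠ v
    ...     | yes _    = trans (+-congʳ (χB-∈ k v∈B)) (solve 0 (𝟏 :- 𝟏 := 𝟎 :* 𝟏) refl)
    ...     | no  γk≢v = contradiction (γ-≢-unique l k v∈l v∈B γl≢v γk≢v) l≢k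

    one : Σχ − Σ𝐈 ≈ 1#
    one = begin
      Σχ − Σ𝐈                                          ≈⟨ ∑-− (λ k → χX k v + χY k v) (λ k → 𝐈 (γ k u) v) ⟨
      ∑ (λ k → (χX k v + χY k v) − 𝐈 (γ k u) v)        ≈⟨ ∑-cong only-l ⟩
      ∑ (λ k → 𝐈 l k * 1#)                             ≈⟨ ∑-𝐈 l (λ _ → 1#) ⟩
      1#                                               ∎

  -- A column of the distance matrix inside one block.

  E : Fin r → V → Carrier
  E k w = D (γ k w) w

  D-gate : ∀ k w {v} → B k v → D v w ≈ E k w + pow (E k w) * D v (γ k w)
  D-gate k w v∈B = trans (reflexive (≡.cong qint (d-through-γ k w v∈B))) (qint-+ (d _ _) (d _ _))

  D-same-side : ∀ k w {v} → B k v → (γ k w ≢ v → d v (γ k w) ≡ 2) →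
                D v w ≈ E k w + pow (E k w) * (1# + q) * (1# − 𝐈 (γ k w) v)
  D-same-side k w {v} v∈B d≡2 = trans (D-gate k w v∈B)
    (+-congˡ (trans (*-congˡ two) (sym (*-assoc _ _ _))))
    where
    two : D v (γ k w) ≈ (1# + q) * (1# − 𝐈 (γ k w) v)
    two with γ k w ≟ᶠ v
    ... | yes γ≡v rewrite γ≡v | d-refl v = solve 1 (λ q → 𝟎 := (𝟏 :+ q) :* (𝟏 :- 𝟏)) refl q
    ... | no  γ≢v rewrite d≡2 γ≢v = trans qint2 (solve 1 (λ q → 𝟏 :+ q := (𝟏 :+ q) :* (𝟏 :- 𝟎)) refl q)

  D-opposite-side : ∀ k w {v} → B k v → d v (γ k w) ≡ 1 → D v w ≈ E k w + pow (E k w)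
  D-opposite-side k w {v} v∈B d≡1 = trans (D-gate k w v∈B) (+-congˡ (trans (*-congˡ one) (*-identityʳ _)))
    where
    one : D v (γ k w) ≈ 1#
    one rewrite d≡1 = solve 1 (λ q → 𝟏 :+ q :* 𝟎 := 𝟏) refl q

  module _ (k : Fin r) (w : V) where
    D-XX : γ k w ∈ X k → ∀ {v} → v ∈ X k → D v w ≈ E k w + pow (E k w) * (1# + q) * (1# − 𝐈 (γ k w) v)
    D-XX γ∈X v∈X = D-same-side k w (X⊆B k v∈X) (λ γ≢v → d-XX k v∈X γ∈X (γ≢v ∘ ≡.sym))

    D-YY : γ k w ∈ Y k → ∀ {v} → v ∈ Y k → D v w ≈ E k w + pow (E k w) * (1# + q) * (1# − 𝐈 (γ k w) v)
    D-YY γ∈Y v∈Y = D-same-side k w (Y⊆B k v∈Y) (λ γ≢v → d-YY k v∈Y γ∈Y (γ≢v ∘ ≡.sym))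

    D-YX : γ k w ∈ X k → ∀ {v} → v ∈ Y k → D v w ≈ E k w + pow (E k w)
    D-YX γ∈X v∈Y = D-opposite-side k w (Y⊆B k v∈Y) (≡.trans (d-sym _ _) (d-XY k γ∈X v∈Y))

    D-XY : γ k w ∈ Y k → ∀ {v} → v ∈ X k → D v w ≈ E k w + pow (E k w)
    D-XY γ∈Y v∈X = D-opposite-side k w (X⊆B k v∈X) (d-XY k v∈X γ∈Y)

  P Q : Fin r → V → Carrier
  P k w = ∑ (λ v → χX k v * D v w)
  Q k w = ∑ (λ v → χY k v * D v w)

  card-X′ : ∀ k → ι ∣ X k ∣ ≈ M1 k + 1#
  card-X′ k rewrite card-X k = solve 1 (λ x → x := x :- 𝟏 :+ 𝟏) refl (ι (m k))

  card-Y′ : ∀ k → ι ∣ Y k ∣ ≈ N1 k + 1#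
  card-Y′ k rewrite card-Y k = solve 1 (λ x → x := x :- 𝟏 :+ 𝟏) refl (ι (n k))

  module _ (k : Fin r) (w : V) where
    private p = pow (E k w)

    P-X : γ k w ∈ X k → P k w ≈ (M1 k + 1#) * (E k w + p * (1# + q)) − p * (1# + q)
    P-X γ∈X = trans (∑-same-side (X k) _ _ γ∈X (D-XX k w γ∈X)) (+-congʳ (*-congʳ (card-X′ k)))

    P-Y : γ k w ∈ Y k → P k w ≈ (M1 k + 1#) * (E k w + p)
    P-Y γ∈Y = trans (∑-opposite-side (X k) _ _ (D-XY k w γ∈Y)) (*-congʳ (card-X′ k))

    Q-Y : γ k w ∈ Y k → Q k w ≈ (N1 k + 1#) * (E k w + p * (1# + q)) − p * (1# + q)
    Q-Y γ∈Y = trans (∑-same-side (Y k) _ _ γ∈Y (D-YY k w γ∈Y)) (+-congʳ (*-congʳ (card-Y′ k)))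

    Q-X : γ k w ∈ X k → Q k w ≈ (N1 k + 1#) * (E k w + p)
    Q-X γ∈X = trans (∑-opposite-side (Y k) _ _ (D-YX k w γ∈X)) (*-congʳ (card-Y′ k))

  module _ (q≉-1 : ¬ (q + 1# ≈ 0#)) (Δ≉0 : ∀ k → ¬ (Δ k ≈ 0#)) where

    WΔ : ∀ k → W k * ((q + 1#) * Δ k) ≈ 1#
    WΔ k = trans (*-comm _ _) (⁻¹-inverse _ (*-≉0 q≉-1 (Δ≉0 k)))

    s : Carrier
    s = (q + 1#) ⁻¹

    s-inv : (q + 1#) * s ≈ 1#
    s-inv = ⁻¹-inverse _ q≉-1

    -- This lets the global term 1/(q + 1) on the diagonal of `𝓛` be handed out to the individual
    -- blocks.
    s≈ : ∀ k → s ≈ W k * Δ k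
    s≈ k = begin
      s                                    ≈⟨ *-identityʳ s ⟨
      s * 1#                               ≈⟨ *-congˡ (WΔ k) ⟨
      s * (W k * ((q + 1#) * Δ k))         ≈⟨ solve 4 (λ s w a b → s :* (w :* (a :* b)) := a :* s :* (w :* b)) refl s (W k) (q + 1#) (Δ k) ⟩
      (q + 1#) * s * (W k * Δ k)           ≈⟨ *-congʳ s-inv ⟩
      1# * (W k * Δ k)                     ≈⟨ *-identityˡ _ ⟩
      W k * Δ k                            ∎

    W≈ : ∀ k → W k ≈ s * (Δ k) ⁻¹
    W≈ k = begin
      W k                          ≈⟨ *-identityʳ _ ⟨
      W k * 1#                     ≈⟨ *-congˡ (⁻¹-inverse _ (Δ≉0 k)) ⟨
      W k * (Δ k * (Δ k) ⁻¹)       ≈⟨ *-assoc _ _ _ ⟨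
      W k * Δ k * (Δ k) ⁻¹         ≈⟨ *-congʳ (s≈ k) ⟨
      s * (Δ k) ⁻¹                 ∎

    -- The product of `𝐱` with the distance matrix.

    𝐱≈ : ∀ v → 𝐱 v ≈ ∑ (λ k → χX k v * xX k + χY k v * xY k) − β v
    𝐱≈ v = +-cong (∑-cong λ k → +-cong (ind≈ (inX k v) _) (ind≈ (inY k v) _)) (-‿cong (dhat−1≈β v))

    Δ-flip : ∀ k → Δ k ≈ q * q * N1 k * M1 k − 1#
    Δ-flip k = solve 3 (λ q a b → q :* q :* a :* b :- 𝟏 := q :* q :* b :* a :- 𝟏) refl q (M1 k) (N1 k)

    -- The value is free of `w`, which is why the product is a constant vector. `local-λ` names the
    -- sides relative to the gate, so the two cases are one identity with the sides exchanged.
    λ-summand : ∀ k w → xX k * P k w + xY k * Q k w − E k w ≈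
                ((q + 1#) * (q + 1#) * M1 k * N1 k − ι (m k) * ι (n k)) * W k
    λ-summand k w with x∈p∪q⁻ (X k) (Y k) (γ∈B k w)
    ... | inj₁ γ∈X = trans (local-λ (M1 k) (N1 k) (Δ k) (W k) (E k w) (P k w) (Q k w) refl (WΔ k) (P-X k w γ∈X) (Q-X k w γ∈X))
      (solve 4 (λ q m n w → ((q :+ 𝟏) :* (q :+ 𝟏) :* (m :- 𝟏) :* (n :- 𝟏) :- (m :- 𝟏 :+ 𝟏) :* (n :- 𝟏 :+ 𝟏)) :* w
                         := ((q :+ 𝟏) :* (q :+ 𝟏) :* (m :- 𝟏) :* (n :- 𝟏) :- m :* n) :* w) refl q (ι (m k)) (ι (n k)) (W k))
    ... | inj₂ γ∈Y = trans (+-congʳ (+-comm _ _)) (trans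
      (local-λ (N1 k) (M1 k) (Δ k) (W k) (E k w) (Q k w) (P k w) (Δ-flip k) (WΔ k) (Q-Y k w γ∈Y) (P-Y k w γ∈Y))
      (solve 4 (λ q m n w → ((q :+ 𝟏) :* (q :+ 𝟏) :* (n :- 𝟏) :* (m :- 𝟏) :- (n :- 𝟏 :+ 𝟏) :* (m :- 𝟏 :+ 𝟏)) :* w
                         := ((q :+ 𝟏) :* (q :+ 𝟏) :* (m :- 𝟏) :* (n :- 𝟏) :- m :* n) :* w) refl q (ι (m k)) (ι (n k)) (W k)))

    -- By `gate-count` the term - `β v` becomes -1 for each block with gate v, and +1 at v = w. The
    -- former complete the block sums to the summands of `λG`; the latter contributes [d(w,w)] = 0.
    𝐱-D : ∀ w → ∑ (λ v → 𝐱 v * D v w) ≈ λG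
    𝐱-D w = begin
      ∑ (λ v → 𝐱 v * D v w)
        ≈⟨ ∑-cong expand ⟩
      ∑ (λ v → ∑ (λ k → summand k v) + 𝐈 w v * D v w)
        ≈⟨ ∑-+ (λ v → ∑ (λ k → summand k v)) (λ v → 𝐈 w v * D v w) ⟩
      ∑ (λ v → ∑ (λ k → summand k v)) + ∑ (λ v → 𝐈 w v * D v w)
        ≈⟨ +-cong (∑-swap (λ v k → summand k v)) (∑-𝐈 w (λ v → D v w)) ⟩
      ∑ (λ k → ∑ (summand k)) + D w w
        ≈⟨ +-cong (∑-cong λ k → block-sum k) (reflexive (≡.cong qint (d-refl w))) ⟩
      λG + 0#
        ≈⟨ +-identityʳ _ ⟩
      λG ∎
      where
      summand : Fin r → V → Carrier
      summand k v = (χX k v * xX k + χY k v * xY k − 𝐈 (γ k w) v) * D v w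

      expand : ∀ v → 𝐱 v * D v w ≈ ∑ (λ k → summand k v) + 𝐈 w v * D v w
      expand v = begin
        𝐱 v * D v w
          ≈⟨ *-congʳ (trans (𝐱≈ v) (+-congˡ (-‿cong (gate-count w v)))) ⟩
        (∑ (λ k → χX k v * xX k + χY k v * xY k) − (∑ (λ k → 𝐈 (γ k w) v) − 𝐈 w v)) * D v w
          ≈⟨ solve 4 (λ x g i d → (x :- (g :- i)) :* d := (x :- g) :* d :+ i :* d) refl
               (∑ (λ k → χX k v * xX k + χY k v * xY k)) (∑ (λ k → 𝐈 (γ k w) v)) (𝐈 w v) (D v w) ⟩
        (∑ (λ k → χX k v * xX k + χY k v * xY k) − ∑ (λ k → 𝐈 (γ k w) v)) * D v w + 𝐈 w v * D v w
          ≈⟨ +-congʳ (trans (*-congʳ (sym (∑-− (λ k → χX k v * xX k + χY k v * xY k) (λ k → 𝐈 (γ k w) v))))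
                            (∑-* (λ k → χX k v * xX k + χY k v * xY k − 𝐈 (γ k w) v) (D v w))) ⟩
        ∑ (λ k → summand k v) + 𝐈 w v * D v w ∎

      block-sum : ∀ k → ∑ (summand k) ≈ ((q + 1#) * (q + 1#) * M1 k * N1 k − ι (m k) * ι (n k)) * W k
      block-sum k = begin
        ∑ (summand k)
          ≈⟨ ∑-cong (λ v → solve 6 (λ x a y b i d → (x :* a :+ y :* b :- i) :* d :=
               a :* (x :* d) :+ b :* (y :* d) :+ con (ℤ.- ℤ.1ℤ) :* (i :* d)) refl
               (χX k v) (xX k) (χY k v) (xY k) (𝐈 (γ k w) v) (D v w)) ⟩
        ∑ (λ v → xX k * (χX k v * D v w) + xY k * (χY k v * D v w) + - 1# * (𝐈 (γ k w) v * D v w))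
          ≈⟨ ∑-lin₃ (xX k) (xY k) (- 1#) (λ v → χX k v * D v w) (λ v → χY k v * D v w) (λ v → 𝐈 (γ k w) v * D v w) ⟩
        xX k * P k w + xY k * Q k w + - 1# * ∑ (λ v → 𝐈 (γ k w) v * D v w)
          ≈⟨ +-congˡ (trans (*-congˡ (∑-𝐈 (γ k w) (λ v → D v w)))
                            (solve 1 (λ e → con (ℤ.- ℤ.1ℤ) :* e := :- e) refl (E k w))) ⟩
        xX k * P k w + xY k * Q k w − E k w
          ≈⟨ λ-summand k w ⟩
        ((q + 1#) * (q + 1#) * M1 k * N1 k − ι (m k) * ι (n k)) * W k ∎

    -- The share of block k in the (u,w) entry of `𝓛` times `D`, with the diagonal 1/(q + 1) counted
    -- once for every block containing u.
    row : Fin r → V → V → Carrier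
    row k u w = χX k u * (W k * (q * Q k w − q * q * N1 k * P k w + Δ k * D u w))
              + χY k u * (W k * (q * P k w − q * q * M1 k * Q k w + Δ k * D u w))

    -- Where the indicator is 1, u is the gate and `E k w` is `D u w`. The power in this form does
    -- not depend on k, so summation over the blocks merely counts the gates at u.
    row-value : ∀ k u w → row k u w ≈
                (χX k u * xX k + χY k u * xY k) − 𝐈 (γ k w) u * pow (D u w)
    row-value k u w = trans by-side (+-congˡ (-‿cong (𝐈-replace (λ v → pow (D v w)) (γ k w) u)))
      where
      e = E k w
      p = pow e
      𝐈γ = 𝐈 (γ k w) u
      RX = W k * (q * Q k w − q * q * N1 k * P k w + Δ k * D u w)
      RY = W k * (q * P k w − q * q * M1 k * Q k w + Δ k * D u w)

      pick-X : RX ≈ xX k − 𝐈γ * p → 1# * RX + 0# * RY ≈ (1# * xX k + 0# * xY k) − 𝐈γ * p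
      pick-X eq = trans (solve 2 (λ x y → 𝟏 :* x :+ 𝟎 :* y := x) refl RX RY) (trans eq
        (solve 3 (λ x y z → x :- z := 𝟏 :* x :+ 𝟎 :* y :- z) refl (xX k) (xY k) (𝐈γ * p)))

      pick-Y : RY ≈ xY k − 𝐈γ * p → 0# * RX + 1# * RY ≈ (0# * xX k + 1# * xY k) − 𝐈γ * p
      pick-Y eq = trans (solve 2 (λ x y → 𝟎 :* x :+ 𝟏 :* y := y) refl RX RY) (trans eq
        (solve 3 (λ x y z → y :- z := 𝟎 :* x :+ 𝟏 :* y :- z) refl (xX k) (xY k) (𝐈γ * p)))

      drop-gate : ∀ {x} → γ k w ≢ u → x ≈ x − 𝐈γ * p
      drop-gate {x} γ≢u = trans (solve 2 (λ x p → x := x :- 𝟎 :* p) refl x p)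
                                (+-congˡ (-‿cong (*-congʳ (reflexive (≡.sym (𝐈-≢ γ≢u))))))

      by-side : row k u w ≈ (χX k u * xX k + χY k u * xY k) − 𝐈γ * p
      by-side with side k u | x∈p∪q⁻ (X k) (Y k) (γ∈B k w)
      ... | in-X u∈X x y | inj₁ γ∈X rewrite x | y = pick-X
              (local-row-same (M1 k) (N1 k) (Δ k) (W k) e (P k w) (Q k w) refl (WΔ k)
                (P-X k w γ∈X) (Q-X k w γ∈X) 𝐈γ (D-XX k w γ∈X u∈X))
      ... | in-X u∈X x y | inj₂ γ∈Y rewrite x | y = pick-X (trans
              (local-row-opposite (N1 k) (M1 k) (Δ k) (W k) e (Q k w) (P k w) (Δ-flip k) (WΔ k)
                (Q-Y k w γ∈Y) (P-Y k w γ∈Y) (D-XY k w γ∈Y u∈X))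
              (drop-gate λ γ≡u → disjoint k u u∈X (≡.subst (_∈ Y k) γ≡u γ∈Y)))
      ... | in-Y u∈Y x y | inj₁ γ∈X rewrite x | y = pick-Y (trans
              (local-row-opposite (M1 k) (N1 k) (Δ k) (W k) e (P k w) (Q k w) refl (WΔ k)
                (P-X k w γ∈X) (Q-X k w γ∈X) (D-YX k w γ∈X u∈Y))
              (drop-gate λ γ≡u → disjoint k u (≡.subst (_∈ X k) γ≡u γ∈X) u∈Y))
      ... | in-Y u∈Y x y | inj₂ γ∈Y rewrite x | y = pick-Y
              (local-row-same (N1 k) (M1 k) (Δ k) (W k) e (Q k w) (P k w) (Δ-flip k) (WΔ k)
                (Q-Y k w γ∈Y) (P-Y k w γ∈Y) 𝐈γ (D-YY k w γ∈Y u∈Y))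
      ... | out u∉B x y | _ rewrite x | y = trans
              (solve 4 (λ a b c d → 𝟎 :* a :+ 𝟎 :* b := 𝟎 :* c :+ 𝟎 :* d) refl RX RY (xX k) (xY k))
              (drop-gate λ γ≡u → u∉B (≡.subst (B k) γ≡u (γ∈B k w)))

    -- Decomposition of `𝓛` into blocks.

    edge-coeff : Fin r → Matrix N
    edge-coeff k u v = χX k u * χY k v + χY k u * χX k v

    -- The diagonal u = v is included: there it yields the sum in `𝐲`, so one formula covers `𝐁` and
    -- `diag 𝐲` up to the term with `β`.
    side-coeff : Fin r → Matrix N
    side-coeff k u v = χX k u * χX k v * N1 k + χY k u * χY k v * M1 k

    -- If both vertices lie in the block, complete bipartiteness determines the adjacency bit e;
    -- otherwise both sides vanish for either value of e.
    edge-entry : ∀ {xu yu xv yv} e z → Position xu yu → Position xv yv →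
                 ((xu ≡ true × yv ≡ true) ⊎ (yu ≡ true × xv ≡ true) → e ≡ true) →
                 ((xu ≡ true × xv ≡ true) ⊎ (yu ≡ true × yv ≡ true) → e ≡ false) →
                 (if e then ind ((xu ∨ yu) ∧ (xv ∨ yv)) (1# * z) else 0#) ≈
                 (ind xu 1# * ind yv 1# + ind yu 1# * ind xv 1#) * z
    edge-entry e z left left _ ¬adj rewrite ¬adj (inj₁ (≡.refl , ≡.refl)) =
      solve 1 (λ z → 𝟎 := (𝟏 :* 𝟎 :+ 𝟎 :* 𝟏) :* z) refl z
    edge-entry e z left right adj _ rewrite adj (inj₁ (≡.refl , ≡.refl)) =
      solve 1 (λ z → 𝟏 :* z := (𝟏 :* 𝟏 :+ 𝟎 :* 𝟎) :* z) refl z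
    edge-entry e z right left adj _ rewrite adj (inj₂ (≡.refl , ≡.refl)) =
      solve 1 (λ z → 𝟏 :* z := (𝟎 :* 𝟎 :+ 𝟏 :* 𝟏) :* z) refl z
    edge-entry e z right right _ ¬adj rewrite ¬adj (inj₂ (≡.refl , ≡.refl)) =
      solve 1 (λ z → 𝟎 := (𝟎 :* 𝟏 :+ 𝟏 :* 𝟎) :* z) refl z
    edge-entry true  z left neither _ _ = solve 1 (λ z → 𝟎 := (𝟏 :* 𝟎 :+ 𝟎 :* 𝟎) :* z) refl z
    edge-entry false z left neither _ _ = solve 1 (λ z → 𝟎 := (𝟏 :* 𝟎 :+ 𝟎 :* 𝟎) :* z) refl z
    edge-entry true  z right neither _ _ = solve 1 (λ z → 𝟎 := (𝟎 :* 𝟎 :+ 𝟏 :* 𝟎) :* z) refl z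
    edge-entry false z right neither _ _ = solve 1 (λ z → 𝟎 := (𝟎 :* 𝟎 :+ 𝟏 :* 𝟎) :* z) refl z
    edge-entry {xv = xv} {yv} true  z neither _ _ _ =
      solve 3 (λ x y z → 𝟎 := (𝟎 :* y :+ 𝟎 :* x) :* z) refl (ind xv 1#) (ind yv 1#) z
    edge-entry {xv = xv} {yv} false z neither _ _ _ =
      solve 3 (λ x y z → 𝟎 := (𝟎 :* y :+ 𝟎 :* x) :* z) refl (ind xv 1#) (ind yv 1#) z

    𝐀≈ : ∀ u v → 𝐀 u v ≈ ∑ (λ k → edge-coeff k u v * (Δ k) ⁻¹)
    𝐀≈ u v = trans (if-∑ (adj u v) (λ k → ind (inB k u ∧ inB k v) (1# ÷ Δ k))) (∑-cong λ k →
      edge-entry (adj u v) ((Δ k) ⁻¹) (position k u) (position k v)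
        (λ { (inj₁ (x , y)) → adj-XY k (member (X k) x) (member (Y k) y)
           ; (inj₂ (y , x)) → ≡.trans (adj-sym u v) (adj-XY k (member (X k) x) (member (Y k) y)) })
        (λ { (inj₁ (x , x′)) → ¬-true (¬adj-XX k (member (X k) x) (member (X k) x′))
           ; (inj₂ (y , y′)) → ¬-true (¬adj-YY k (member (Y k) y) (member (Y k) y′)) }))
      where
      member : ∀ (p : Subset N) {x} → lookup p x ≡ true → x ∈ p
      member p {x} = lookup⇒[]= x p

      ¬-true : ∀ {b} → b ≢ true → b ≡ false
      ¬-true {true}  b≢t = contradiction ≡.refl b≢t
      ¬-true {false} _   = ≡.refl

    𝐁𝐲≈ : ∀ u v → 𝐁 u v + diag 𝐲 u v ≈ ∑ (λ k → side-coeff k u v * (Δ k) ⁻¹) − β u * 𝐈 u v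
    𝐁𝐲≈ u v with u ≟ᶠ v
    ... | yes ≡.refl = begin
      0# + 𝐲 u * 1#
        ≈⟨ solve 1 (λ y → 𝟎 :+ y :* 𝟏 := y) refl (𝐲 u) ⟩
      𝐲 u
        ≈⟨ +-cong (∑-cong λ k → diagonal (inX k u) (inY k u) (N1 k) (M1 k) ((Δ k) ⁻¹))
                  (-‿cong (trans (dhat−1≈β u) (sym (*-identityʳ _)))) ⟩
      ∑ (λ k → side-coeff k u u * (Δ k) ⁻¹) − β u * 1# ∎
      where
      square : ∀ b x → ind b x ≈ ind b 1# * ind b 1# * x
      square true  x = solve 1 (λ x → x := 𝟏 :* 𝟏 :* x) refl x
      square false x = solve 1 (λ x → 𝟎 := 𝟎 :* 𝟎 :* x) refl x

      diagonal : ∀ a b x y t → ind a (x * t) + ind b (y * t) ≈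
                 (ind a 1# * ind a 1# * x + ind b 1# * ind b 1# * y) * t
      diagonal a b x y t = trans (+-cong (square a _) (square b _))
        (solve 5 (λ a b x y t → a :* a :* (x :* t) :+ b :* b :* (y :* t) := (a :* a :* x :+ b :* b :* y) :* t)
          refl (ind a 1#) (ind b 1#) x y t)
    ... | no _ = begin
      ∑ (λ k → ind (inX k u ∧ inX k v) (N1 k ÷ Δ k) + ind (inY k u ∧ inY k v) (M1 k ÷ Δ k)) + 𝐲 u * 0#
        ≈⟨ +-congʳ (∑-cong λ k → trans (+-cong (ind-∧ (inX k u) (inX k v) _) (ind-∧ (inY k u) (inY k v) _))
             (solve 7 (λ a b c d x y t → a :* b :* (x :* t) :+ c :* d :* (y :* t)
                                      := (a :* b :* x :+ c :* d :* y) :* t) refl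
               (χX k u) (χX k v) (χY k u) (χY k v) (N1 k) (M1 k) ((Δ k) ⁻¹))) ⟩
      ∑ (λ k → side-coeff k u v * (Δ k) ⁻¹) + 𝐲 u * 0#
        ≈⟨ solve 3 (λ c y b → c :+ y :* 𝟎 := c :- b :* 𝟎) refl (∑ (λ k → side-coeff k u v * (Δ k) ⁻¹)) (𝐲 u) (β u) ⟩
      ∑ (λ k → side-coeff k u v * (Δ k) ⁻¹) − β u * 0# ∎

    𝓛≈ : ∀ u v → 𝓛 u v ≈ q * s * ∑ (λ k → edge-coeff k u v * (Δ k) ⁻¹)
                        − q * q * s * (∑ (λ k → side-coeff k u v * (Δ k) ⁻¹) − β u * 𝐈 u v)
                        + s * 𝐈 u v
    𝓛≈ u v = trans
      (solve 6 (λ q s a b y i → q :* s :* a :- q :* q :* s :* b :- q :* q :* s :* y :+ 𝟏 :* s :* i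
                             := q :* s :* a :- q :* q :* s :* (b :+ y) :+ s :* i)
        refl q s (𝐀 u v) (𝐁 u v) (diag 𝐲 u v) (𝐈 u v))
      (+-congʳ (+-cong (*-congˡ (𝐀≈ u v)) (-‿cong (*-congˡ (𝐁𝐲≈ u v)))))

    𝓛-sym : ∀ u v → 𝓛 u v ≈ 𝓛 v u
    𝓛-sym u v = trans (𝓛≈ u v) (trans (+-cong (+-cong
        (*-congˡ (∑-cong λ k → *-congʳ (edge-coeff-sym k)))
        (-‿cong (*-congˡ (+-cong (∑-cong λ k → *-congʳ (side-coeff-sym k)) (-‿cong β𝐈-sym)))))
        (*-congˡ (reflexive (𝐈-sym u v))))
      (sym (𝓛≈ v u)))
      where
      edge-coeff-sym : ∀ k → edge-coeff k u v ≈ edge-coeff k v u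
      edge-coeff-sym k = solve 4 (λ a b c d → a :* b :+ c :* d := d :* c :+ b :* a) refl (χX k u) (χY k v) (χY k u) (χX k v)

      side-coeff-sym : ∀ k → side-coeff k u v ≈ side-coeff k v u
      side-coeff-sym k = +-cong (*-congʳ (*-comm _ _)) (*-congʳ (*-comm _ _))

      β𝐈-sym : β u * 𝐈 u v ≈ β v * 𝐈 v u
      β𝐈-sym = trans (*-comm _ _) (trans (𝐈-replace β u v)
                 (trans (*-comm _ _) (*-congˡ (reflexive (𝐈-sym u v)))))

    block-entry : Fin r → Matrix N
    block-entry k u v = q * edge-coeff k u v * W k − q * q * side-coeff k u v * W k + (χX k u + χY k u) * 𝐈 u v * (W k * Δ k)

    -- Giving 1/(q + 1) to each of the `β u` + 1 blocks at u exceeds the diagonal of `𝓛` by `β u`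
    -- copies, while `diag 𝐲` leaves q^2/(q + 1) times `β u`. The balance is (q^2 - 1)/(q + 1) = q -
    -- 1 times `β u`.
    𝓛-blocks : ∀ u v → 𝓛 u v ≈ ∑ (λ k → block-entry k u v) + (q − 1#) * β u * 𝐈 u v
    𝓛-blocks u v = begin
      𝓛 u v
        ≈⟨ 𝓛≈ u v ⟩
      q * s * a − q * q * s * (b − (h − 1#) * i) + s * i
        ≈⟨ solve 6 (λ q s a b h i →
             q :* s :* a :- q :* q :* s :* (b :- (h :- 𝟏) :* i) :+ s :* i :=
             q :* s :* a :+ (:- (q :* q :* s)) :* b :+ s :* i :* h
               :+ (q :- 𝟏) :* ((q :+ 𝟏) :* s) :* (h :- 𝟏) :* i) refl q s a b h i ⟩
      q * s * a + - (q * q * s) * b + s * i * h + (q − 1#) * ((q + 1#) * s) * (h − 1#) * i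
        ≈⟨ +-cong (sym (∑-lin₃ (q * s) (- (q * q * s)) (s * i)
                          (λ k → edge-coeff k u v * (Δ k) ⁻¹) (λ k → side-coeff k u v * (Δ k) ⁻¹) (λ k → χX k u + χY k u)))
                  (*-congʳ (*-congʳ (trans (*-congˡ s-inv) (*-identityʳ _)))) ⟩
      ∑ (λ k → q * s * (edge-coeff k u v * (Δ k) ⁻¹) + - (q * q * s) * (side-coeff k u v * (Δ k) ⁻¹) + s * i * (χX k u + χY k u))
        + (q − 1#) * (h − 1#) * i
        ≈⟨ +-congʳ (∑-cong λ k → trans
             (solve 7 (λ q s a b t i h →
                q :* s :* (a :* t) :+ (:- (q :* q :* s)) :* (b :* t) :+ s :* i :* h :=
                q :* a :* (s :* t) :- q :* q :* b :* (s :* t) :+ h :* i :* s)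
               refl q s (edge-coeff k u v) (side-coeff k u v) ((Δ k) ⁻¹) i (χX k u + χY k u))
             (+-cong (+-cong (*-congˡ (sym (W≈ k))) (-‿cong (*-congˡ (sym (W≈ k))))) (*-congˡ (s≈ k)))) ⟩
      ∑ (λ k → block-entry k u v) + (q − 1#) * (h − 1#) * i ∎
      where
      a = ∑ (λ k → edge-coeff k u v * (Δ k) ⁻¹)
      b = ∑ (λ k → side-coeff k u v * (Δ k) ⁻¹)
      h = ∑ (λ k → χX k u + χY k u)
      i = 𝐈 u v

    block-entry-D : ∀ k u w → ∑ (λ v → block-entry k u v * D v w) ≈ row k u w
    block-entry-D k u w = begin
      ∑ (λ v → block-entry k u v * D v w)
        ≈⟨ ∑-cong (λ v → solve 11 (λ q xu yu xv yv m n w δ i d →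
             (q :* (xu :* yv :+ yu :* xv) :* w :- q :* q :* (xu :* xv :* n :+ yu :* yv :* m) :* w
               :+ (xu :+ yu) :* i :* (w :* δ)) :* d :=
             (yu :* (w :* q) :- xu :* (w :* q :* q :* n)) :* (xv :* d)
             :+ (xu :* (w :* q) :- yu :* (w :* q :* q :* m)) :* (yv :* d)
             :+ ((xu :+ yu) :* (w :* δ)) :* (i :* d)) refl
             q (χX k u) (χY k u) (χX k v) (χY k v) (M1 k) (N1 k) (W k) (Δ k) (𝐈 u v) (D v w)) ⟩
      ∑ (λ v → cX * (χX k v * D v w) + cY * (χY k v * D v w) + cI * (𝐈 u v * D v w))
        ≈⟨ ∑-lin₃ cX cY cI (λ v → χX k v * D v w) (λ v → χY k v * D v w) (λ v → 𝐈 u v * D v w) ⟩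
      cX * P k w + cY * Q k w + cI * ∑ (λ v → 𝐈 u v * D v w)
        ≈⟨ +-congˡ (*-congˡ (∑-𝐈 u (λ v → D v w))) ⟩
      cX * P k w + cY * Q k w + cI * D u w
        ≈⟨ solve 10 (λ q xu yu m n w δ p p′ d →
             (yu :* (w :* q) :- xu :* (w :* q :* q :* n)) :* p
             :+ (xu :* (w :* q) :- yu :* (w :* q :* q :* m)) :* p′
             :+ ((xu :+ yu) :* (w :* δ)) :* d :=
             xu :* (w :* (q :* p′ :- q :* q :* n :* p :+ δ :* d))
             :+ yu :* (w :* (q :* p :- q :* q :* m :* p′ :+ δ :* d))) refl
             q (χX k u) (χY k u) (M1 k) (N1 k) (W k) (Δ k) (P k w) (Q k w) (D u w) ⟩
      row k u w ∎
      where
      cX = χY k u * (W k * q) − χX k u * (W k * q * q * N1 k)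
      cY = χX k u * (W k * q) − χY k u * (W k * q * q * M1 k)
      cI = (χX k u + χY k u) * (W k * Δ k)

    -- By `gate-count` the vertex u is the gate of w in `β u` + `𝐈 w u` blocks. As `pow δ` - (q - 1)
    -- δ = 1, the surplus (q - 1) `β u` δ reduces `β u` times `pow δ` to `β u`, which completes x to
    -- `𝐱 u`. On the diagonal δ = 0, so the remaining gate term is just `𝐈`.
    𝓛-D : ∀ u w → ∑ (λ v → 𝓛 u v * D v w) ≈ 𝐱 u − 𝐈 u w
    𝓛-D u w = begin
      ∑ (λ v → 𝓛 u v * D v w)
        ≈⟨ ∑-cong (λ v → trans (*-congʳ (𝓛-blocks u v)) (trans (distribʳ _ _ _)
             (+-cong (∑-* (λ k → block-entry k u v) (D v w)) (*-assoc _ _ _)))) ⟩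
      ∑ (λ v → ∑ (λ k → block-entry k u v * D v w) + (q − 1#) * β u * (𝐈 u v * D v w))
        ≈⟨ ∑-+ (λ v → ∑ (λ k → block-entry k u v * D v w)) (λ v → (q − 1#) * β u * (𝐈 u v * D v w)) ⟩
      ∑ (λ v → ∑ (λ k → block-entry k u v * D v w)) + ∑ (λ v → (q − 1#) * β u * (𝐈 u v * D v w))
        ≈⟨ +-cong (trans (∑-swap (λ v k → block-entry k u v * D v w))
                         (∑-cong λ k → trans (block-entry-D k u w) (row-value k u w)))
                  (trans (sym (*-∑ ((q − 1#) * β u) (λ v → 𝐈 u v * D v w)))
                         (*-congˡ (∑-𝐈 u (λ v → D v w)))) ⟩
      ∑ (λ k → (χX k u * xX k + χY k u * xY k) − 𝐈 (γ k w) u * pow δ) + (q − 1#) * β u * δ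
        ≈⟨ +-congʳ (trans (∑-− (λ k → χX k u * xX k + χY k u * xY k) (λ k → 𝐈 (γ k w) u * pow δ))
             (+-congˡ (-‿cong (sym (∑-* (λ k → 𝐈 (γ k w) u) (pow δ)))))) ⟩
      x − g * pow δ + (q − 1#) * β u * δ
        ≈⟨ +-congʳ (+-congˡ (-‿cong (*-congʳ (trans
             (solve 2 (λ g i → g := g :- i :+ i) refl g (𝐈 w u)) (+-congʳ (sym (gate-count w u))))))) ⟩
      x − (β u + 𝐈 w u) * pow δ + (q − 1#) * β u * δ
        ≈⟨ solve 5 (λ q x b i d → x :- (b :+ i) :* (𝟏 :+ (q :- 𝟏) :* d) :+ (q :- 𝟏) :* b :* d :=
             x :- b :- i :- (q :- 𝟏) :* (i :* d)) refl q x (β u) (𝐈 w u) δ ⟩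
      x − β u − 𝐈 w u − (q − 1#) * (𝐈 w u * δ)
        ≈⟨ +-cong (+-cong (sym (𝐱≈ u)) (-‿cong (reflexive (𝐈-sym w u)))) (-‿cong (*-congˡ 𝐈δ≈0)) ⟩
      𝐱 u − 𝐈 u w − (q − 1#) * 0#
        ≈⟨ solve 2 (λ x q → x :- (q :- 𝟏) :* 𝟎 := x) refl (𝐱 u − 𝐈 u w) q ⟩
      𝐱 u − 𝐈 u w ∎
      where
      δ = D u w
      x = ∑ (λ k → χX k u * xX k + χY k u * xY k)
      g = ∑ (λ k → 𝐈 (γ k w) u)

      𝐈δ≈0 : 𝐈 w u * δ ≈ 0#
      𝐈δ≈0 = trans (sym (𝐈-replace (λ v → D v w) w u))
                   (trans (*-congˡ (reflexive (≡.cong qint (d-refl w)))) (zeroʳ _))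

    -- The two-sided inverse.

    module _ (λ≉0 : ¬ (λG ≈ 0#)) where

      𝓓inv-D : ∀ i j → (𝓓inv ⊗ D) i j ≈ 𝐈 i j
      𝓓inv-D i j = begin
        ∑ (λ v → (- 𝓛 i v + l * (𝐱 i * 𝐱 v)) * D v j)
          -- The third summand `0# * 0#` pads the expression to the shape of `∑-lin₃`.
          ≈⟨ ∑-cong (λ v → solve 5 (λ a l x y d → (:- a :+ l :* (x :* y)) :* d :=
               con (ℤ.- ℤ.1ℤ) :* (a :* d) :+ (l :* x) :* (y :* d) :+ 𝟎 :* 𝟎) refl (𝓛 i v) l (𝐱 i) (𝐱 v) (D v j)) ⟩
        ∑ (λ v → - 1# * (𝓛 i v * D v j) + l * 𝐱 i * (𝐱 v * D v j) + 0# * 0#)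
          ≈⟨ ∑-lin₃ (- 1#) (l * 𝐱 i) 0# (λ v → 𝓛 i v * D v j) (λ v → 𝐱 v * D v j) (λ _ → 0#) ⟩
        - 1# * ∑ (λ v → 𝓛 i v * D v j) + l * 𝐱 i * ∑ (λ v → 𝐱 v * D v j) + 0# * ∑ {N} (λ _ → 0#)
          ≈⟨ +-cong (+-cong (*-congˡ (𝓛-D i j)) (*-congˡ (𝐱-D j))) (zeroˡ _) ⟩
        - 1# * (𝐱 i − 𝐈 i j) + 1# * λG ⁻¹ * 𝐱 i * λG + 0#
          ≈⟨ solve 4 (λ x e λ⁻ l → con (ℤ.- ℤ.1ℤ) :* (x :- e) :+ 𝟏 :* λ⁻ :* x :* l :+ 𝟎 :=
               e :+ x :* (l :* λ⁻ :- 𝟏)) refl (𝐱 i) (𝐈 i j) (λG ⁻¹) λG ⟩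
        𝐈 i j + 𝐱 i * (λG * λG ⁻¹ − 1#)
          ≈⟨ +-congˡ (*-congˡ (+-congʳ (⁻¹-inverse λG λ≉0))) ⟩
        𝐈 i j + 𝐱 i * (1# − 1#)
          ≈⟨ solve 2 (λ e x → e :+ x :* (𝟏 :- 𝟏) := e) refl (𝐈 i j) (𝐱 i) ⟩
        𝐈 i j ∎
        where l = 1# ÷ λG

      D-𝓓inv : ∀ i j → (D ⊗ 𝓓inv) i j ≈ 𝐈 i j
      D-𝓓inv i j = begin
        ∑ (λ v → D i v * 𝓓inv v j)
          ≈⟨ ∑-cong (λ v → trans (*-comm _ _) (*-cong (+-cong (-‿cong (𝓛-sym v j)) (*-congˡ (*-comm _ _)))
                                                       (reflexive (≡.cong qint (d-sym i v))))) ⟩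
        ∑ (λ v → 𝓓inv j v * D v i)     ≈⟨ 𝓓inv-D j i ⟩
        𝐈 j i                          ≈⟨ reflexive (𝐈-sym j i) ⟩
        𝐈 i j                          ∎

theorem5p9 : ∀ {c ℓ} (F : Field c ℓ) (q : Field.Carrier F)
  {N r : ℕ} (G : Graph N) (X Y : Fin r → Subset N) (m n : Fin r → ℕ) →
  BiBlockStructure G r X Y m n →
  N +ℕ r ≡ ∑ℕ (λ k → m k +ℕ n k) +ℕ 1 →
  1 < r →
  (d : Fin N → Fin N → ℕ) → (∀ u v → IsDistance G u v (d u v)) →
  let open Field F
      open QDist F q
      open Bi G X Y m n
  in ¬ (q + 1# ≈ 0#) →
     (∀ k → ¬ (q * q * M1 k * N1 k ≈ 1#)) →
     (∀ k → ¬ ((q + 1#) * (q + 1#) * M1 k * N1 k ≈ ι (m k) * ι (n k))) →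
     ¬ (λG ≈ 0#) →
     (∀ i j → (qDistMatrix d ⊗ 𝓓inv) i j ≈ 𝐈 i j) ×
     (∀ i j → (𝓓inv ⊗ qDistMatrix d) i j ≈ 𝐈 i j)
theorem5p9 F q G X Y m n bb _ _ d dist q≉-1 Δ≉1 _ λ≉0 =
  D-𝓓inv q≉-1 Δ≉0 λ≉0 , 𝓓inv-D q≉-1 Δ≉0 λ≉0
  where
  open Inverse F q G X Y m n bb d dist
  Δ≉0 = λ k → LinearAlgebra.≉⇒−≉0 F q (Δ≉1 k)
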